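{- For each positive integer $n$, place $n$ hyper-queens at random on the $3$-dimensional chessboard with side length $n$, and let $\mu_{n,3}$ be the expected proportion of safe spaces. Then in the limit $n\to\infty$ the expected proportion of safe spaces lies between $1/e^6$ and $1/e^{9/2}$, that is, $$\frac{1}{e^{6}}\le \liminf_{n\to\infty}\mu_{n,3}\le\limsup_{n\to\infty}\mu_{n,3}\le \frac{1}{e^{9/2}}.$$
   Context: The $3$-dimensional board of side length $n$ is the set of spaces $\{1,\dots,n\}^3$. "Placing $n$ pieces at random" means that the set of occupied spaces (the board configuration) is chosen uniformly among all $\binom{n^3}{n}$ subsets of $n$ distinct spaces. A hyper-queen attacks every space that a hyper-rook or a hyper-bishop at the same position would attack. A hyper-rook at $(a_1,a_2,a_3)$ attacks $(x_1,x_2,x_3)$ if $x_i=a_i$ for some $i$. A hyper-bishop at $(a_1,a_2,a_3)$ attacks $(x_1,x_2,x_3)$ if $(x_1-a_1)\pm(x_2-a_2)\pm(x_3-a_3)=0$ for some choice of the two signs. A space is safe under a board configuration if it is neither occupied nor attacked by any of the placed pieces. The expected proportion of safe spaces $\mu_{n,3}$ is the expected number of safe spaces divided by $n^3$. -}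

module Defs where

open import Data.Nat.Base as ℕ using (ℕ; zero; suc)
import Data.Nat.Properties as ℕ
open import Data.Integer.Base as ℤ using (ℤ; +_; 0ℤ)
import Data.Integer.Properties as ℤ
import Data.Rational.Unnormalised.Base as ℚᵘ
import Data.Rational.Unnormalised.Properties as ℚᵘ
open import Data.Rational.Base
open import Data.Rational.Properties
open import Data.Rational.Solver using (module +-*-Solver)
open import Data.Fin.Base using (Fin; toℕ)
import Data.Fin.Properties as Fin
open import Data.List.Base
  using (List; []; _∷_; _++_; map; filter; length; allFin; cartesianProduct)
open import Data.Nat.ListAction using (sum)
import Data.List.Membership.DecPropositional as DecMembership
open import Data.List.Membership.Propositional using (_∉_)
open import Data.List.Relation.Unary.All as All using (All)
open import Data.Product.Base using (_×_; _,_; proj₁; proj₂; ∃-syntax)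
open import Data.Product.Properties using (≡-dec)
open import Data.Sum.Base using (_⊎_; inj₁; inj₂)
open import Level using (0ℓ)
open import Relation.Binary.PropositionalEquality hiding ([_])
open import Relation.Nullary.Decidable using (Dec; ¬?; _×-dec_; _⊎-dec_)
open import Relation.Nullary.Negation using (¬_)
open import Relation.Unary using (Pred; _⊆_; _∈_)

------------------------------------------------------------------------
-- The board

-- Coordinates run over 0,…,n-1 instead of 1,…,n; attacks depend only on
-- coordinate differences.
Space : ℕ → Set
Space n = Fin n × Fin n × Fin n

spaces : (n : ℕ) → List (Space n)
spaces n = cartesianProduct (allFin n) (cartesianProduct (allFin n) (allFin n))

diff : ∀ {n} → Fin n → Fin n → ℤ
diff x a = + toℕ x ℤ.- + toℕ a

RookAttacks : ∀ {n} → Space n → Space n → Set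
RookAttacks (a₁ , a₂ , a₃) (x₁ , x₂ , x₃) = x₁ ≡ a₁ ⊎ x₂ ≡ a₂ ⊎ x₃ ≡ a₃

BishopAttacks : ∀ {n} → Space n → Space n → Set
BishopAttacks (a₁ , a₂ , a₃) (x₁ , x₂ , x₃) =
    diff x₁ a₁ ℤ.+ diff x₂ a₂ ℤ.+ diff x₃ a₃ ≡ 0ℤ
  ⊎ diff x₁ a₁ ℤ.+ diff x₂ a₂ ℤ.- diff x₃ a₃ ≡ 0ℤ
  ⊎ diff x₁ a₁ ℤ.- diff x₂ a₂ ℤ.+ diff x₃ a₃ ≡ 0ℤ
  ⊎ diff x₁ a₁ ℤ.- diff x₂ a₂ ℤ.- diff x₃ a₃ ≡ 0ℤ

QueenAttacks : ∀ {n} → Space n → Space n → Set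
QueenAttacks a x = RookAttacks a x ⊎ BishopAttacks a x

Safe : ∀ {n} → List (Space n) → Space n → Set
Safe B x = x ∉ B × All (λ a → ¬ QueenAttacks a x) B

queenAttacks? : ∀ {n} (a x : Space n) → Dec (QueenAttacks a x)
queenAttacks? (a₁ , a₂ , a₃) (x₁ , x₂ , x₃) =
  (x₁ Fin.≟ a₁ ⊎-dec x₂ Fin.≟ a₂ ⊎-dec x₃ Fin.≟ a₃)
  ⊎-dec (_ ℤ.≟ _ ⊎-dec _ ℤ.≟ _ ⊎-dec _ ℤ.≟ _ ⊎-dec _ ℤ.≟ _)

safe? : ∀ {n} (B : List (Space n)) (x : Space n) → Dec (Safe B x)
safe? {n} B x = ¬? (x ∈? B) ×-dec All.all? (λ a → ¬? (queenAttacks? a x)) B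
  where open DecMembership (≡-dec (Fin._≟_ {n}) (≡-dec (Fin._≟_ {n}) (Fin._≟_ {n})))

numSafe : ∀ {n} → List (Space n) → ℕ
numSafe {n} B = length (filter (safe? B) (spaces n))

-- The sublists of length k.  On a list without repetitions these represent
-- each k-element subset exactly once.
choose : ∀ {A : Set} → ℕ → List A → List (List A)
choose zero    _        = [] ∷ []
choose (suc k) []       = []
choose (suc k) (x ∷ xs) = map (x ∷_) (choose k xs) ++ choose (suc k) xs

configurations : (n : ℕ) → List (List (Space n))
configurations n = choose n (spaces n)

-- Expectation of f under the uniform distribution on a nonempty list of
-- outcomes; the value for the empty list is a convention.
expectation : ∀ {A : Set} → (A → ℕ) → List A → ℚ
expectation f []          = 0ℚ
expectation f ωs@(_ ∷ _) = + sum (map f ωs) / length ωs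

μ : (n : ℕ) .{{_ : ℕ.NonZero n}} → ℚ
μ n = expectation numSafe (configurations n)
    * ((+ 1 / (n ℕ.^ 3)) {{ℕ.m^n≢0 n 3}})

------------------------------------------------------------------------
-- Real numbers as Cauchy sequences of rationals

record ℝ : Set where
  field
    seq    : ℕ → ℚ
    cauchy : ∀ ε → 0ℚ < ε →
             ∃[ N ] (∀ m n → N ℕ.≤ m → N ℕ.≤ n → ∣ seq m - seq n ∣ ≤ ε)

open ℝ public

-- q ∈ below x means q < x, and q ∈ above x means x < q.
below above : ℝ → Pred ℚ 0ℓ
below x q = ∃[ r ] q < r × ∃[ N ] (∀ n → N ℕ.≤ n → r ≤ seq x n)
above x q = ∃[ r ] r < q × ∃[ N ] (∀ n → N ℕ.≤ n → seq x n ≤ r)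

-- The limit inferior sup_N inf_{n≥N} aₙ is given by its lower cut
-- {q | q < liminf a}, the limit superior inf_N sup_{n≥N} aₙ by its upper cut
-- {q | limsup a < q}.  (Constructively, neither need be a Cauchy real.)
liminf limsup : (ℕ → ℚ) → Pred ℚ 0ℓ
liminf a q = ∃[ r ] q < r × ∃[ N ] (∀ n → N ℕ.≤ n → r ≤ a n)
limsup a q = ∃[ r ] r < q × ∃[ N ] (∀ n → N ℕ.≤ n → a n ≤ r)

infix 4 _≤liminf_ _limsup≤_

_≤liminf_ : ℝ → (ℕ → ℚ) → Set
x ≤liminf a = below x ⊆ liminf a

liminf≤limsup : (ℕ → ℚ) → Set
liminf≤limsup a = ∀ {q r} → q ∈ liminf a → r ∈ limsup a → q < r

_limsup≤_ : (ℕ → ℚ) → ℝ → Set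
a limsup≤ y = above y ⊆ limsup a

------------------------------------------------------------------------
-- Reciprocals of reals

1≤p⇒nonZero : ∀ {p} → 1ℚ ≤ p → NonZero p
1≤p⇒nonZero {p} 1≤p = pos⇒nonZero p {{positive (<-≤-trans (positive⁻¹ 1ℚ) 1≤p)}}

-- A lower bound of 1 on the approximations is all that is needed below.
reciprocal : (x : ℝ) → (∀ n → 1ℚ ≤ seq x n) → ℝ
reciprocal x 1≤x = record
  { seq    = λ n → (1/ seq x n) {{1≤p⇒nonZero (1≤x n)}}
  ; cauchy = λ ε 0<ε → let N , h = cauchy x ε 0<ε in
      N , λ m n N≤m N≤n → ≤-trans (contract (1≤x m) (1≤x n)) (h m n N≤m N≤n)
  }
  where
  inv : ∀ {p} → 1ℚ ≤ p → ℚ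
  inv {p} 1≤p = (1/ p) {{1≤p⇒nonZero 1≤p}}

  inv-nonNeg : ∀ {p} (1≤p : 1ℚ ≤ p) → NonNegative (inv 1≤p)
  inv-nonNeg {p} 1≤p =
    pos⇒nonNeg (inv 1≤p) {{1/pos⇒pos p {{positive (<-≤-trans (positive⁻¹ 1ℚ) 1≤p)}}}}

  inv≤1 : ∀ {p} (1≤p : 1ℚ ≤ p) → inv 1≤p ≤ 1ℚ
  inv≤1 {p} 1≤p = begin
    inv 1≤p       ≡⟨ *-identityʳ (inv 1≤p) ⟨
    inv 1≤p * 1ℚ  ≤⟨ *-monoˡ-≤-nonNeg (inv 1≤p) {{inv-nonNeg 1≤p}} 1≤p ⟩
    inv 1≤p * p   ≡⟨ *-inverseˡ p {{1≤p⇒nonZero 1≤p}} ⟩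
    1ℚ            ∎
    where open ≤-Reasoning

  ∣inv∣≤1 : ∀ {p} (1≤p : 1ℚ ≤ p) → ∣ inv 1≤p ∣ ≤ 1ℚ
  ∣inv∣≤1 1≤p = ≤-trans
    (≤-reflexive (0≤p⇒∣p∣≡p (nonNegative⁻¹ (inv 1≤p) {{inv-nonNeg 1≤p}}))) (inv≤1 1≤p)

  shrink : ∀ d r → ∣ r ∣ ≤ 1ℚ → ∣ d * r ∣ ≤ ∣ d ∣
  shrink d r r≤1 = begin
    ∣ d * r ∣      ≡⟨ ∣p*q∣≡∣p∣*∣q∣ d r ⟩
    ∣ d ∣ * ∣ r ∣  ≤⟨ *-monoˡ-≤-nonNeg ∣ d ∣ {{∣-∣-nonNeg d}} r≤1 ⟩
    ∣ d ∣ * 1ℚ     ≡⟨ *-identityʳ ∣ d ∣ ⟩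
    ∣ d ∣          ∎
    where open ≤-Reasoning

  contract : ∀ {p q} (1≤p : 1ℚ ≤ p) (1≤q : 1ℚ ≤ q) →
             ∣ inv 1≤p - inv 1≤q ∣ ≤ ∣ p - q ∣
  contract {p} {q} 1≤p 1≤q = begin
    ∣ u - v ∣              ≡⟨ cong ∣_∣ eq ⟩
    ∣ - ((p - q) * u * v) ∣  ≡⟨ ∣-p∣≡∣p∣ ((p - q) * u * v) ⟩
    ∣ (p - q) * u * v ∣    ≤⟨ shrink ((p - q) * u) v (∣inv∣≤1 1≤q) ⟩
    ∣ (p - q) * u ∣        ≤⟨ shrink (p - q) u (∣inv∣≤1 1≤p) ⟩
    ∣ p - q ∣              ∎
    where
    open ≤-Reasoning
    u = inv 1≤p
    v = inv 1≤q
    eq : u - v ≡ - ((p - q) * u * v)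
    eq = trans
      (cong₂ _-_
        (trans (sym (*-identityʳ u)) (cong (u *_) (sym (*-inverseˡ q {{1≤p⇒nonZero 1≤q}}))))
        (trans (sym (*-identityʳ v)) (cong (v *_) (sym (*-inverseˡ p {{1≤p⇒nonZero 1≤p}})))))
      (solve 4 (λ p q u v →
        u :* (v :* q) :- v :* (u :* p) := :- ((p :- q) :* u :* v)) refl p q u v)
      where open +-*-Solver

------------------------------------------------------------------------
-- The exponential function at nonnegative rationals

-- x ^ k / k !
expTerm : ℚ → ℕ → ℚ
expTerm x zero    = 1ℚ
expTerm x (suc k) = expTerm x k * (x * (+ 1 / suc k))

expSum : ℚ → ℕ → ℚ
expSum x zero    = expTerm x zero
expSum x (suc k) = expSum x k + expTerm x (suc k)

module ExpConvergence (x : ℚ) (0≤x : NonNegative x) where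
  open ≤-Reasoning

  private
    t = expTerm x
    S = expSum x

    ι : ℕ → ℚ
    ι n = + n / 1

  t-nonNeg : ∀ k → NonNegative (t k)
  t-nonNeg zero    = _
  t-nonNeg (suc k) = nonNeg*nonNeg⇒nonNeg (t k) {{t-nonNeg k}} (x * (+ 1 / suc k))
    {{nonNeg*nonNeg⇒nonNeg x {{0≤x}} (+ 1 / suc k) {{normalize-nonNeg 1 (suc k)}}}}

  S-step : ∀ k → S k ≤ S (suc k)
  S-step k = begin
    S k             ≡⟨ +-identityʳ (S k) ⟨
    S k + 0ℚ        ≤⟨ +-monoʳ-≤ (S k) (nonNegative⁻¹ (t (suc k)) {{t-nonNeg (suc k)}}) ⟩
    S k + t (suc k) ∎

  1≤S : ∀ k → 1ℚ ≤ S k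
  1≤S zero    = ≤-refl
  1≤S (suc k) = ≤-trans (1≤S k) (S-step k)

  private
    ι≃ : ∀ n → toℚᵘ (ι n) ℚᵘ.≃ ℚᵘ.mkℚᵘ (+ n) 0
    ι≃ n = toℚᵘ-fromℚᵘ (ℚᵘ.mkℚᵘ (+ n) 0)

    ι-mono : ∀ {m n} → m ℕ.≤ n → ι m ≤ ι n
    ι-mono {m} {n} m≤n = toℚᵘ-cancel-≤
      (ℚᵘ.≤-respˡ-≃ (ℚᵘ.≃-sym (ι≃ m)) (ℚᵘ.≤-respʳ-≃ (ℚᵘ.≃-sym (ι≃ n))
        (ℚᵘ.*≤* (ℤ.*-monoʳ-≤-nonNeg (+ 1) (ℤ.+≤+ m≤n)))))

    ι-+ : ∀ m n → ι (m ℕ.+ n) ≡ ι m + ι n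
    ι-+ m n = toℚᵘ-injective (ℚᵘ.≃-trans (ι≃ (m ℕ.+ n))
      (ℚᵘ.≃-trans (ℚᵘ.*≡* (cong (ℤ._* + 1) (sym
          (cong₂ ℤ._+_ (ℤ.*-identityʳ (+ m)) (ℤ.*-identityʳ (+ n))))))
      (ℚᵘ.≃-sym (ℚᵘ.≃-trans (toℚᵘ-homo-+ (ι m) (ι n)) (ℚᵘ.+-cong (ι≃ m) (ι≃ n))))))

    ι-inverse : ∀ n → ι (suc n) * (+ 1 / suc n) ≡ 1ℚ
    ι-inverse n = toℚᵘ-injective (ℚᵘ.≃-trans
      (toℚᵘ-homo-* (ι (suc n)) (+ 1 / suc n))
      (ℚᵘ.≃-trans (ℚᵘ.*-cong (ι≃ (suc n)) (toℚᵘ-fromℚᵘ (ℚᵘ.mkℚᵘ (+ 1) n)))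
      (ℚᵘ.*-inverseʳ (ℚᵘ.mkℚᵘ (+ suc n) 0))))

    ι-nonNeg : ∀ n → NonNegative (ι n)
    ι-nonNeg n = normalize-nonNeg n 1

    archimedean : ∀ p → ∃[ n ] p ≤ ι n
    archimedean p@(mkℚ a d-1 _) = ℤ.∣ a ∣ ,
      toℚᵘ-cancel-≤ (ℚᵘ.≤-respʳ-≃ (ℚᵘ.≃-sym (ι≃ ℤ.∣ a ∣)) (ℚᵘ.*≤* (bound a)))
      where
      bound : ∀ a → a ℤ.* + 1 ℤ.≤ + ℤ.∣ a ∣ ℤ.* + suc d-1
      bound (+ n)       = subst₂ ℤ._≤_ (ℤ.pos-* n 1) (ℤ.pos-* n (suc d-1))
                            (ℤ.+≤+ (ℕ.*-monoʳ-≤ n (ℕ.s≤s ℕ.z≤n)))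
      bound (ℤ.-[1+ n ]) = ℤ.-≤+

    K : ℕ
    K = proj₁ (archimedean (x + x))

    halve : ∀ k → K ℕ.≤ k → t (suc k) + t (suc k) ≤ t k
    halve k K≤k = begin
      t k * (x * r) + t k * (x * r)
        ≡⟨ solve 3 (λ t x r → t :* (x :* r) :+ t :* (x :* r) := t :* ((x :+ x) :* r))
             refl (t k) x r ⟩
      t k * ((x + x) * r)
        ≤⟨ *-monoˡ-≤-nonNeg (t k) {{t-nonNeg k}}
             (*-monoʳ-≤-nonNeg r {{normalize-nonNeg 1 (suc k)}}
               (≤-trans (proj₂ (archimedean (x + x)))
                        (ι-mono (ℕ.m≤n⇒m≤1+n K≤k)))) ⟩
      t k * (ι (suc k) * r)  ≡⟨ cong (t k *_) (ι-inverse k) ⟩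
      t k * 1ℚ               ≡⟨ *-identityʳ (t k) ⟩
      t k                    ∎
      where
      open +-*-Solver
      r = + 1 / suc k

    decay : ∀ j → ι (suc j) * t (j ℕ.+ K) ≤ t K
    decay zero    = ≤-reflexive (*-identityˡ (t K))
    decay (suc j) = begin
      ι (2 ℕ.+ j) * t′
        ≤⟨ *-monoʳ-≤-nonNeg t′ {{t-nonNeg (suc (j ℕ.+ K))}}
             (ι-mono (ℕ.s≤s (ℕ.m≤n+m (suc j) j))) ⟩
      ι (suc j ℕ.+ suc j) * t′        ≡⟨ cong (_* t′) (ι-+ (suc j) (suc j)) ⟩
      (ι (suc j) + ι (suc j)) * t′
        ≡⟨ solve 2 (λ i t → (i :+ i) :* t := i :* (t :+ t)) refl (ι (suc j)) t′ ⟩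
      ι (suc j) * (t′ + t′)
        ≤⟨ *-monoˡ-≤-nonNeg (ι (suc j)) {{ι-nonNeg (suc j)}}
             (halve (j ℕ.+ K) (ℕ.m≤n+m K j)) ⟩
      ι (suc j) * t (j ℕ.+ K)         ≤⟨ decay j ⟩
      t K                             ∎
      where
      open +-*-Solver
      t′ = t (suc (j ℕ.+ K))

    t-small : ∀ ε → 0ℚ < ε → ∃[ N ] K ℕ.≤ N × t N ≤ ε
    t-small ε 0<ε = j ℕ.+ K , ℕ.m≤n+m K j ,
      *-cancelˡ-≤-pos (ι (suc j)) {{normalize-pos (suc j) 1}} (begin
        ι (suc j) * t (j ℕ.+ K)  ≤⟨ decay j ⟩
        t K                      ≡⟨ sym (trans (*-assoc (t K) 1/ε ε)
                                      (trans (cong (t K *_) (*-inverseˡ ε {{ε≢0}}))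
                                             (*-identityʳ (t K)))) ⟩
        t K * 1/ε * ε            ≤⟨ *-monoʳ-≤-nonNeg ε {{pos⇒nonNeg ε {{ε>0}}}}
                                      (≤-trans (proj₂ (archimedean (t K * 1/ε)))
                                               (ι-mono (ℕ.n≤1+n j))) ⟩
        ι (suc j) * ε            ∎)
      where
      ε>0 = positive 0<ε
      ε≢0 = pos⇒nonZero ε {{ε>0}}
      1/ε = (1/ ε) {{ε≢0}}
      j   = proj₁ (archimedean (t K * 1/ε))

    S-mono : ∀ d n → S n ≤ S (d ℕ.+ n)
    S-mono zero    n = ≤-refl
    S-mono (suc d) n = ≤-trans (S-mono d n) (S-step (d ℕ.+ n))

    S-bounded : ∀ d n → K ℕ.≤ n → S (d ℕ.+ n) + t (d ℕ.+ n) ≤ S n + t n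
    S-bounded zero    n K≤n = ≤-refl
    S-bounded (suc d) n K≤n = begin
      S k + t (suc k) + t (suc k)    ≡⟨ +-assoc (S k) (t (suc k)) (t (suc k)) ⟩
      S k + (t (suc k) + t (suc k))  ≤⟨ +-monoʳ-≤ (S k)
                                          (halve k (ℕ.≤-trans K≤n (ℕ.m≤n+m n d))) ⟩
      S k + t k                      ≤⟨ S-bounded d n K≤n ⟩
      S n + t n                      ∎
      where k = d ℕ.+ n

    S-upper : ∀ d n → K ℕ.≤ n → S (d ℕ.+ n) ≤ S n + t n
    S-upper d n K≤n = begin
      S k        ≡⟨ +-identityʳ (S k) ⟨
      S k + 0ℚ   ≤⟨ +-monoʳ-≤ (S k) (nonNegative⁻¹ (t k) {{t-nonNeg k}}) ⟩
      S k + t k  ≤⟨ S-bounded d n K≤n ⟩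
      S n + t n  ∎
      where k = d ℕ.+ n

    close : ∀ {a b l e} → l ≤ a → a ≤ l + e → l ≤ b → b ≤ l + e → ∣ a - b ∣ ≤ e
    close {a} {b} {l} {e} l≤a a≤u l≤b b≤u with ∣p∣≡p∨∣p∣≡-p (a - b)
    ... | inj₁ eq = begin
      ∣ a - b ∣  ≡⟨ eq ⟩
      a - b      ≤⟨ +-mono-≤ a≤u (neg-antimono-≤ l≤b) ⟩
      l + e - l  ≡⟨ solve 2 (λ l e → l :+ e :- l := e) refl l e ⟩
      e          ∎
      where open +-*-Solver
    ... | inj₂ eq = begin
      ∣ a - b ∣  ≡⟨ eq ⟩
      - (a - b)  ≡⟨ solve 2 (λ a b → :- (a :- b) := b :- a) refl a b ⟩
      b - a      ≤⟨ +-mono-≤ b≤u (neg-antimono-≤ l≤a) ⟩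
      l + e - l  ≡⟨ solve 2 (λ l e → l :+ e :- l := e) refl l e ⟩
      e          ∎
      where open +-*-Solver

  S-cauchy : ∀ ε → 0ℚ < ε →
             ∃[ N ] (∀ m n → N ℕ.≤ m → N ℕ.≤ n → ∣ S m - S n ∣ ≤ ε)
  S-cauchy ε 0<ε with t-small ε 0<ε
  ... | N , K≤N , tN≤ε = N , λ m n N≤m N≤n →
    close (lo N≤m) (hi N≤m) (lo N≤n) (hi N≤n)
    where
    lo : ∀ {m} → N ℕ.≤ m → S N ≤ S m
    lo {m} N≤m = subst (λ k → S N ≤ S k) (ℕ.m∸n+n≡m N≤m) (S-mono (m ℕ.∸ N) N)
    hi : ∀ {m} → N ℕ.≤ m → S m ≤ S N + ε
    hi {m} N≤m = subst (λ k → S k ≤ S N + ε) (ℕ.m∸n+n≡m N≤m)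
      (≤-trans (S-upper (m ℕ.∸ N) N K≤N) (+-monoʳ-≤ (S N) tN≤ε))

-- The real number e ^ x = Σ x ^ k / k !.
exp : (x : ℚ) {{_ : NonNegative x}} → ℝ
exp x {{0≤x}} = record { seq = expSum x ; cauchy = ExpConvergence.S-cauchy x 0≤x }

1/exp : (x : ℚ) {{_ : NonNegative x}} → ℝ
1/exp x {{0≤x}} = reciprocal (exp x) (ExpConvergence.1≤S x 0≤x)

{-# OPTIONS --safe #-}
-- A space x is safe with probability C(n³ − a, n) / C(n³, n) ≈ exp(−a/n²), where a is the number
-- of spaces attacking x; so it suffices that 9/2 n² − O(n) ≤ a ≤ 6 n² + O(1).  The rook planes
-- contribute 3 n² and meet the bishop planes in O(n) spaces.  In doubled centred coordinates
-- X, Y, Z of x, reflecting the layers C ↦ −C turns four times the bishop count into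
--   Σ_C Σ_± max(0, 2n − ∣X ± Y ± Z ± C∣),
-- which is symmetric in X, Y, Z, C; for ∣X∣, ∣Y∣, ∣Z∣, ∣C∣ ≤ n the inner sum is at least 6n and at
-- most 16n − 8∣C∣, and 2 Σ ∣C∣ ≈ n².  The binomial quotient and
-- the limit are handled by two inequalities for the partial sums of the exponential series,
-- (1 − t) Sₖ(w + t) ≤ Sₖ(w) and (1 + t) Sₖ(w) ≤ Sₖ₊₁(w + t) for w, t ≥ 0.
module Submission where

open import Data.Nat.Base using (ℕ; suc)
open import Data.Integer.Base using (+_)
open import Data.Rational.Base using (_/_)
open import Data.Product.Base using (_×_; _,_)
open import Defs

-- The constants come from the two extreme positions. For a central space, X = Y = Z = 0, the inner
-- sum is exactly 16n - 8∣C∣, which gives 3n² + 3n² attackers. In the idealised corner X = Y = Z = n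
-- the two terms with ∣3n ± C∣ vanish and the other six add up to exactly 6n, which gives 3n² +
-- 3n²/2. The obstacle to the lower bound is truncation: which planes leave the board depends on the
-- position and on the layer. The reflection makes the layer height C a fourth coordinate on a par
-- with X, Y, Z, so all four may be sorted by size, and then it is known in advance which terms can
-- be given up. Both bounds hold for every space separately, so averaging over spaces costs nothing.
-- The exponential is available only through rational partial sums, without a functional equation,
-- so a product of n factors 1 - t or 1 + t is absorbed one factor at a time. The first inequality
-- keeps the truncation index fixed; the second raises it by one per factor, so there the index
-- grows with n.

-- Finite sums of indicators, and the length of a diagonal of a square board

module Summation where
  open import Data.Bool.Base using (if_then_else_)
  open import Data.Empty using (⊥-elim)
  open import Data.Fin.Base using (Fin; zero; suc; toℕ; opposite)
  open import Data.Fin.Permutation using (reverse)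
  open import Data.Fin.Properties using (toℕ-injective; suc-injective; toℕ<n; _≟_)
  open import Data.Integer.Base as ℤ using (+_; -[1+_])
  import Data.Integer.Properties as ℤ
  open import Data.Nat.Base
  open import Data.Nat.Properties as ℕ hiding (_≟_; suc-injective)
  open import Algebra.Properties.Semiring.Sum +-*-semiring public
    using (sum; ∑-distrib-+; ∑-comm; sum-cong-≗; sum-init-last; ∑-permute; *-distribˡ-sum; *-distribʳ-sum)
  open import Function.Base using (case_of_)
  open import Relation.Binary.PropositionalEquality
  open import Relation.Nullary

  private variable
    n : ℕ
    P Q : Set

  sum-mono : ∀ {n} {f g : Fin n → ℕ} → (∀ i → f i ≤ g i) → sum f ≤ sum g
  sum-mono {zero}  f≤g = z≤n
  sum-mono {suc n} f≤g = +-mono-≤ (f≤g zero) (sum-mono (λ i → f≤g (suc i)))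

  sum-const : ∀ n k → sum {n} (λ _ → k) ≡ n * k
  sum-const zero    k = refl
  sum-const (suc n) k = cong (_+_ k) (sum-const n k)

  -- The reflection of the board in one coordinate. It turns antidiagonals into diagonals, and later
  -- the layers into their mirror images.
  sum-reverse : (f : Fin n → ℕ) → sum f ≡ sum (λ i → f (opposite i))
  sum-reverse f = ∑-permute f reverse

  𝟙 : Dec P → ℕ
  𝟙 p = if does p then 1 else 0

  𝟙-yes : (p : Dec P) → P → 𝟙 p ≡ 1
  𝟙-yes (yes _) _ = refl
  𝟙-yes (no ¬p) p = ⊥-elim (¬p p)

  𝟙-no : (p : Dec P) → ¬ P → 𝟙 p ≡ 0
  𝟙-no (no _) _ = refl
  𝟙-no (yes p) ¬p = ⊥-elim (¬p p)

  𝟙-cong : (p : Dec P) (q : Dec Q) → (P → Q) → (Q → P) → 𝟙 p ≡ 𝟙 q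
  𝟙-cong p (yes q) f g = 𝟙-yes p (g q)
  𝟙-cong p (no ¬q) f g = 𝟙-no p (λ x → ¬q (f x))

  𝟙-⊎ : (p : Dec P) (q : Dec Q) → 𝟙 (p ⊎-dec q) ≤ 𝟙 p + 𝟙 q
  𝟙-⊎ (yes _) q       = s≤s z≤n
  𝟙-⊎ (no _)  (yes _) = s≤s z≤n
  𝟙-⊎ (no _)  (no _)  = z≤n

  𝟙-∩ : (p : Dec P) (q : Dec Q) → 𝟙 p + 𝟙 q ≡ 𝟙 (p ⊎-dec q) + 𝟙 p * 𝟙 q
  𝟙-∩ (yes _) (yes _) = refl
  𝟙-∩ (yes _) (no _)  = refl
  𝟙-∩ (no _)  (yes _) = refl
  𝟙-∩ (no _)  (no _)  = refl

  𝟙-disjoint : (p : Dec P) (q : Dec Q) → (P → ¬ Q) → 𝟙 p + 𝟙 q ≤ 𝟙 (p ⊎-dec q)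
  𝟙-disjoint (yes p) (yes q) ¬pq = ⊥-elim (¬pq p q)
  𝟙-disjoint (yes _) (no _)  _   = ≤-refl
  𝟙-disjoint (no _)  (yes _) _   = ≤-refl
  𝟙-disjoint (no _)  (no _)  _   = ≤-refl

  𝟙-¬ : (p : Dec P) → 𝟙 (¬? p) + 𝟙 p ≡ 1
  𝟙-¬ (yes _) = refl
  𝟙-¬ (no _)  = refl

  sum-none : {p : Fin n → Set} (p? : ∀ i → Dec (p i)) → (∀ i → ¬ p i) →
             sum (λ i → 𝟙 (p? i)) ≡ 0
  sum-none {n} p? ¬p = trans (sum-cong-≗ (λ i → 𝟙-no (p? i) (¬p i)))
                             (trans (sum-const n 0) (*-zeroʳ n))

  sum-unique : {p : Fin n → Set} (p? : ∀ i → Dec (p i)) →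
               (∀ i j → p i → p j → i ≡ j) → sum (λ i → 𝟙 (p? i)) ≤ 1
  sum-unique {zero}  p? uniq = z≤n
  sum-unique {suc n} p? uniq with p? zero
  ... | yes p₀ = ≤-reflexive (cong suc (sum-none (λ i → p? (suc i))
                   (λ i pᵢ → case uniq zero (suc i) p₀ pᵢ of λ ())))
  ... | no _   = sum-unique (λ i → p? (suc i)) (λ i j pᵢ pⱼ → suc-injective (uniq _ _ pᵢ pⱼ))

  sum-toℕ : ∀ n k → sum {n} (λ i → 𝟙 (toℕ i ℕ.≟ k)) ≡ 𝟙 (k <? n)
  sum-toℕ zero    k       = refl
  sum-toℕ (suc n) zero    = cong suc (sum-none {n} (λ i → suc (toℕ i) ℕ.≟ 0) (λ i ()))
  sum-toℕ (suc n) (suc k) = trans (sum-toℕ n k) (𝟙-cong (k <? n) (suc k <? suc n) s≤s s≤s⁻¹)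

  sum-≟ : (x : Fin n) → sum (λ i → 𝟙 (x ≟ i)) ≡ 1
  sum-≟ {n} x = trans
    (sum-cong-≗ (λ i → 𝟙-cong (x ≟ i) (toℕ i ℕ.≟ toℕ x)
      (λ eq → cong toℕ (sym eq)) (λ eq → toℕ-injective (sym eq))))
    (trans (sum-toℕ n (toℕ x)) (𝟙-yes (toℕ x <? n) (toℕ<n x)))

  private
    ∸-step : ∀ k n → 𝟙 (k <? n) + (n ∸ suc k) ≡ n ∸ k
    ∸-step k n = case k <? n of λ where
      (yes k<n) → trans (cong (λ i → i + (n ∸ suc k)) (𝟙-yes (k <? n) k<n)) (sym (+-∸-assoc 1 k<n))
      (no  k≮n) → trans (cong₂ _+_ (𝟙-no (k <? n) k≮n) (m≤n⇒m∸n≡0 (m≤n⇒m≤1+n (≮⇒≥ k≮n))))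
                        (sym (m≤n⇒m∸n≡0 (≮⇒≥ k≮n)))

    diff? : ∀ (a b : ℕ) d → Dec (+ a ℤ.- + b ≡ d)
    diff? a b d = (+ a ℤ.- + b) ℤ.≟ d

    suc-suc : ∀ a b → + suc a ℤ.- + suc b ≡ + a ℤ.- + b
    suc-suc a b = trans (ℤ.[+m]-[+n]≡m⊖n (suc a) (suc b)) (trans (ℤ.[1+m]⊖[1+n]≡m⊖n a b) (sym (ℤ.[+m]-[+n]≡m⊖n a b)))

    firstColumn : ∀ n d → sum {n} (λ i → 𝟙 (diff? (suc (toℕ i)) 0 (+ suc d))) ≡ 𝟙 (d <? n)
    firstColumn n d = trans
      (sum-cong-≗ {n} (λ i → 𝟙-cong (diff? (suc (toℕ i)) 0 (+ suc d)) (toℕ i ℕ.≟ d)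
        (λ eq → ℕ.suc-injective (ℤ.+-injective (trans (sym (ℤ.+-identityʳ _)) eq)))
        (λ eq → trans (ℤ.+-identityʳ _) (cong (λ k → + suc k) eq))))
      (sum-toℕ n d)

    firstRow : ∀ n d → sum {n} (λ j → 𝟙 (diff? 0 (suc (toℕ j)) -[1+ d ])) ≡ 𝟙 (d <? n)
    firstRow n d = trans
      (sum-cong-≗ {n} (λ j → 𝟙-cong (diff? 0 (suc (toℕ j)) -[1+ d ]) (toℕ j ℕ.≟ d)
        ℤ.-[1+-injective (cong -[1+_])))
      (sum-toℕ n d)

  -- Induction by removing the first row and the first column. The remaining board has the same
  -- differences i - j, and the removed cells contain one cell of the diagonal exactly when ∣d∣ ≤ n:
  -- the corner, a column cell or a row cell according to the sign of d.
  diagonal-count : ∀ n d → sum {n} (λ i → sum {n} (λ j → 𝟙 (diff? (toℕ i) (toℕ j) d))) ≡ n ∸ ℤ.∣ d ∣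
  diagonal-count zero    d = sym (0∸n≡0 ℤ.∣ d ∣)
  diagonal-count (suc n) d = trans
    (cong (_+_ (𝟙 (diff? 0 0 d) + row)) (trans (∑-distrib-+ {n} _ _) (cong (_+_ column) inner)))
    (go d)
    where
    row    = sum {n} (λ j → 𝟙 (diff? 0 (suc (toℕ j)) d))
    column = sum {n} (λ i → 𝟙 (diff? (suc (toℕ i)) 0 d))
    inner : sum {n} (λ i → sum {n} (λ j → 𝟙 (diff? (suc (toℕ i)) (suc (toℕ j)) d))) ≡ n ∸ ℤ.∣ d ∣
    inner = trans
      (sum-cong-≗ {n} (λ i → sum-cong-≗ {n} (λ j →
        cong (λ e → 𝟙 (e ℤ.≟ d)) (suc-suc (toℕ i) (toℕ j)))))
      (diagonal-count n d)
    go : ∀ d → 𝟙 (diff? 0 0 d) + sum {n} (λ j → 𝟙 (diff? 0 (suc (toℕ j)) d)) +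
               (sum {n} (λ i → 𝟙 (diff? (suc (toℕ i)) 0 d)) + (n ∸ ℤ.∣ d ∣)) ≡ suc n ∸ ℤ.∣ d ∣
    go (+ zero)   = cong₂ (λ r c → suc r + (c + n))
      (sum-none {n} (λ j → diff? 0 (suc (toℕ j)) (+ 0)) (λ j ()))
      (sum-none {n} (λ i → diff? (suc (toℕ i)) 0 (+ 0)) (λ i ()))
    go (+ suc k)  = trans (cong₂ (λ r c → r + (c + (n ∸ suc k)))
      (sum-none {n} (λ j → diff? 0 (suc (toℕ j)) (+ suc k)) (λ j ())) (firstColumn n k)) (∸-step k n)
    go (-[1+ k ]) = trans (cong₂ (λ r c → r + (c + (n ∸ suc k)))
      (firstRow n k) (sum-none {n} (λ i → diff? (suc (toℕ i)) 0 -[1+ k ]) (λ i ()))) (∸-step k n)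

-- Upper and lower bounds for the sum of truncated diagonal lengths over all sign patterns

module Tent where
  open import Data.Integer.Base as ℤ using (ℤ; +_; ∣_∣; _+_; _-_; -_; +≤+)
  open import Data.Integer.Properties as ℤ using (≤-trans; ≤-reflexive)
  import Data.Integer.Tactic.RingSolver as ℤ-Solver
  open import Data.Nat.Base as ℕ using (ℕ; _∸_)
  import Data.Nat.Properties as ℕ
  import Data.Nat.Tactic.RingSolver as ℕ-Solver
  open import Data.Sum.Base using (_⊎_; inj₁; inj₂)
  open import Relation.Binary.PropositionalEquality

  -- Whatever signs the two absolute values resolve to, their sum is one of ±2u, ±2v. Together with
  -- the next lemma this replaces the identity ∣u + v∣ + ∣u - v∣ = 2 max(∣u∣, ∣v∣).
  ∣+∣+∣-∣≤ : ∀ u v {m} → ∣ u ∣ ℕ.≤ m → ∣ v ∣ ℕ.≤ m → ∣ u + v ∣ ℕ.+ ∣ u - v ∣ ℕ.≤ m ℕ.+ m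
  ∣+∣+∣-∣≤ u v {m} u≤m v≤m = ℤ.drop‿+≤+ (bound (ℤ.+∣i∣≡i⊎+∣i∣≡-i (u + v)) (ℤ.+∣i∣≡i⊎+∣i∣≡-i (u - v)))
    where
    upper : ∀ i → ∣ i ∣ ℕ.≤ m → i ℤ.≤ + m
    upper i i≤m = ≤-trans (i≤∣i∣ i) (+≤+ i≤m)
      where
      i≤∣i∣ : ∀ i → i ℤ.≤ + ∣ i ∣
      i≤∣i∣ (+ _)      = ℤ.≤-refl
      i≤∣i∣ ℤ.-[1+ _ ] = ℤ.-≤+
    double : ∀ i → ∣ i ∣ ℕ.≤ m → i + i ℤ.≤ + m + + m
    double i i≤m = ℤ.+-mono-≤ (upper i i≤m) (upper i i≤m)
    double⁻ : ∀ i → ∣ i ∣ ℕ.≤ m → - i + - i ℤ.≤ + m + + m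
    double⁻ i i≤m = double (- i) (subst (ℕ._≤ m) (sym (ℤ.∣-i∣≡∣i∣ i)) i≤m)
    bound : ∀ {s t} → s ≡ u + v ⊎ s ≡ - (u + v) → t ≡ u - v ⊎ t ≡ - (u - v) → s + t ℤ.≤ + m + + m
    bound (inj₁ refl) (inj₁ refl) = ≤-trans (≤-reflexive (eq u v)) (double u u≤m)
      where
      eq : ∀ u v → u + v + (u - v) ≡ u + u
      eq = ℤ-Solver.solve-∀
    bound (inj₁ refl) (inj₂ refl) = ≤-trans (≤-reflexive (eq u v)) (double v v≤m)
      where
      eq : ∀ u v → u + v + - (u - v) ≡ v + v
      eq = ℤ-Solver.solve-∀
    bound (inj₂ refl) (inj₁ refl) = ≤-trans (≤-reflexive (eq u v)) (double⁻ v v≤m)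
      where
      eq : ∀ u v → - (u + v) + (u - v) ≡ - v + - v
      eq = ℤ-Solver.solve-∀
    bound (inj₂ refl) (inj₂ refl) = ≤-trans (≤-reflexive (eq u v)) (double⁻ u u≤m)
      where
      eq : ∀ u v → - (u + v) + - (u - v) ≡ - u + - u
      eq = ℤ-Solver.solve-∀

  ∣+∣+∣-∣≥ : ∀ u v → ∣ v ∣ ℕ.+ ∣ v ∣ ℕ.≤ ∣ u + v ∣ ℕ.+ ∣ u - v ∣
  ∣+∣+∣-∣≥ u v = begin
    ∣ v ∣ ℕ.+ ∣ v ∣              ≡⟨ cong (ℕ._+_ ∣ v ∣) (ℕ.+-identityʳ _) ⟨
    2 ℕ.* ∣ v ∣                  ≡⟨ ℤ.∣i*j∣≡∣i∣*∣j∣ (+ 2) v ⟨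
    ∣ + 2 ℤ.* v ∣                ≡⟨ cong ∣_∣ (eq u v) ⟩
    ∣ (u + v) - (u - v) ∣        ≤⟨ ℤ.∣i-j∣≤∣i∣+∣j∣ (u + v) (u - v) ⟩
    ∣ u + v ∣ ℕ.+ ∣ u - v ∣      ∎
    where
    open ℕ.≤-Reasoning
    eq : ∀ u v → + 2 ℤ.* v ≡ (u + v) - (u - v)
    eq = ℤ-Solver.solve-∀

  -- Twice the number of cells on the diagonal a − b = t/2 of the n × n board (t even).
  tent : ℕ → ℤ → ℕ
  tent n t = 2 ℕ.* n ∸ ∣ t ∣

  spread : ℤ → (ℤ → ℕ) → ℤ → ℕ
  spread a g t = g (t + a) ℕ.+ g (t - a)

  -- The eight values a ± b ± c ± d. Here a is the point of evaluation instead of a fourth `spread`: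
  -- the tent is even, so sixteen sign patterns would count every value twice.
  planes : ℕ → ℤ → ℤ → ℤ → ℤ → ℕ
  planes n a b c d = spread b (spread c (spread d (tent n))) a

  Even : (ℤ → ℕ) → Set
  Even g = ∀ t → g (- t) ≡ g t

  tent-even : ∀ n → Even (tent n)
  tent-even n t = cong (2 ℕ.* n ∸_) (ℤ.∣-i∣≡∣i∣ t)

  spread-cong : ∀ a {g h} → (∀ t → g t ≡ h t) → ∀ t → spread a g t ≡ spread a h t
  spread-cong a g≗h t = cong₂ ℕ._+_ (g≗h _) (g≗h _)

  spread-even : ∀ a {g} → Even g → Even (spread a g)
  spread-even a {g} even t = trans (ℕ.+-comm (g (- t + a)) _) (cong₂ ℕ._+_
    (trans (cong g (eq₁ t a)) (even (t + a))) (trans (cong g (eq₂ t a)) (even (t - a))))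
    where
    eq₁ : ∀ t a → - t - a ≡ - (t + a)
    eq₁ = ℤ-Solver.solve-∀
    eq₂ : ∀ t a → - t + a ≡ - (t - a)
    eq₂ = ℤ-Solver.solve-∀

  spread-neg : ∀ a g t → spread (- a) g t ≡ spread a g t
  spread-neg a g t = trans (ℕ.+-comm (g (t + - a)) _)
    (cong (λ s → g (t + s) ℕ.+ g (t - a)) (ℤ.neg-involutive a))

  spread-comm : ∀ a b g t → spread a (spread b g) t ≡ spread b (spread a g) t
  spread-comm a b g t = trans
    (interchange (g (t + a + b)) (g (t + a - b)) (g (t - a + b)) (g (t - a - b)))
    (cong₂ ℕ._+_ (cong₂ ℕ._+_ (cong g (e₁ t a b)) (cong g (e₂ t a b)))
                 (cong₂ ℕ._+_ (cong g (e₃ t a b)) (cong g (e₄ t a b))))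
    where
    interchange : ∀ p q r s → p ℕ.+ q ℕ.+ (r ℕ.+ s) ≡ p ℕ.+ r ℕ.+ (q ℕ.+ s)
    interchange = ℕ-Solver.solve-∀
    e₁ : ∀ t a b → t + a + b ≡ t + b + a
    e₁ = ℤ-Solver.solve-∀
    e₂ : ∀ t a b → t - a + b ≡ t + b - a
    e₂ = ℤ-Solver.solve-∀
    e₃ : ∀ t a b → t + a - b ≡ t - b + a
    e₃ = ℤ-Solver.solve-∀
    e₄ : ∀ t a b → t - a - b ≡ t - b - a
    e₄ = ℤ-Solver.solve-∀

  -- Evenness lets the point of evaluation trade places with an offset. This is the one exchange
  -- that commuting the `spread` operators does not give, and it makes `planes` fully symmetric.
  spread-swap : ∀ a b {g} → Even g → spread b g a ≡ spread a g b
  spread-swap a b {g} even = cong₂ ℕ._+_ (cong g (ℤ.+-comm a b))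
    (trans (cong g (eq a b)) (even (b - a)))
    where
    eq : ∀ a b → a - b ≡ - (b - a)
    eq = ℤ-Solver.solve-∀

  spread-∣∣ : ∀ a g t → spread (+ ∣ a ∣) g t ≡ spread a g t
  spread-∣∣ a g t with ℤ.+∣i∣≡i⊎+∣i∣≡-i a
  ... | inj₁ eq = cong (λ a → spread a g t) eq
  ... | inj₂ eq = trans (cong (λ a → spread a g t) eq) (spread-neg a g t)

  even-∣∣ : ∀ {g} → Even g → ∀ t → g (+ ∣ t ∣) ≡ g t
  even-∣∣ {g} even t with ℤ.+∣i∣≡i⊎+∣i∣≡-i t
  ... | inj₁ eq = cong g eq
  ... | inj₂ eq = trans (cong g eq) (even t)

  module _ (n : ℕ) where
    private
      T₁ : ℤ → ℤ → ℕ
      T₁ d = spread d (tent n)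
      T₂ : ℤ → ℤ → ℤ → ℕ
      T₂ c d = spread c (T₁ d)

      T₁-even : ∀ d → Even (T₁ d)
      T₁-even d = spread-even d (tent-even n)

      T₂-even : ∀ c d → Even (T₂ c d)
      T₂-even c d = spread-even c (T₁-even d)

    planes-swap₁ : ∀ a b c d → planes n a b c d ≡ planes n b a c d
    planes-swap₁ a b c d = spread-swap a b (T₂-even c d)

    planes-swap₂ : ∀ a b c d → planes n a b c d ≡ planes n a c b d
    planes-swap₂ a b c d = spread-comm b c (T₁ d) a

    planes-swap₃ : ∀ a b c d → planes n a b c d ≡ planes n a b d c
    planes-swap₃ a b c d = spread-cong b (spread-comm c d (tent n)) a

    planes-∣∣ : ∀ a b c d → planes n (+ ∣ a ∣) (+ ∣ b ∣) (+ ∣ c ∣) (+ ∣ d ∣) ≡ planes n a b c d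
    planes-∣∣ a b c d = trans (even-∣∣ (spread-even (+ ∣ b ∣) (T₂-even (+ ∣ c ∣) (+ ∣ d ∣))) a)
      (trans (spread-∣∣ b (T₂ (+ ∣ c ∣) (+ ∣ d ∣)) a)
      (spread-cong b (λ t → trans (spread-∣∣ c (T₁ (+ ∣ d ∣)) t)
        (spread-cong c (spread-∣∣ d (tent n)) t)) a))

    -- If neither tent is cut off, ∣t + d∣ + ∣t - d∣ ≥ 2∣d∣ is subtracted from 4n. If one is cut
    -- off, it contributes 0, the other contributes at most 2n, and 2∣d∣ ≤ 2n fills the gap.
    tent-pair-≤ : ∀ d → ∣ d ∣ ℕ.≤ n → ∀ t → spread d (tent n) t ℕ.+ 2 ℕ.* ∣ d ∣ ℕ.≤ 4 ℕ.* n
    tent-pair-≤ d d≤n t = truncated (∣ t + d ∣) (∣ t - d ∣) (∣+∣+∣-∣≥ t d)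
      where
      open ℕ.≤-Reasoning
      split : ∀ p q r s → p ℕ.+ q ℕ.+ (r ℕ.+ s) ≡ (p ℕ.+ r) ℕ.+ (q ℕ.+ s)
      split = ℕ-Solver.solve-∀
      four : ∀ n → 2 ℕ.* n ℕ.+ 2 ℕ.* n ≡ 4 ℕ.* n
      four = ℕ-Solver.solve-∀
      twice : ∀ d → 2 ℕ.* d ≡ d ℕ.+ d
      twice = ℕ-Solver.solve-∀
      truncated : ∀ p q → ∣ d ∣ ℕ.+ ∣ d ∣ ℕ.≤ p ℕ.+ q →
                  (2 ℕ.* n ∸ p) ℕ.+ (2 ℕ.* n ∸ q) ℕ.+ 2 ℕ.* ∣ d ∣ ℕ.≤ 4 ℕ.* n
      truncated p q d≤pq with ℕ.≤-total p (2 ℕ.* n) | ℕ.≤-total q (2 ℕ.* n)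
      ... | inj₂ p≥ | _ = begin
        (2 ℕ.* n ∸ p) ℕ.+ (2 ℕ.* n ∸ q) ℕ.+ 2 ℕ.* ∣ d ∣
          ≤⟨ ℕ.+-mono-≤ (ℕ.+-mono-≤ (ℕ.≤-reflexive (ℕ.m≤n⇒m∸n≡0 p≥)) (ℕ.m∸n≤m (2 ℕ.* n) q)) (ℕ.*-monoʳ-≤ 2 d≤n) ⟩
        2 ℕ.* n ℕ.+ 2 ℕ.* n  ≡⟨ four n ⟩
        4 ℕ.* n ∎
      ... | _ | inj₂ q≥ = begin
        (2 ℕ.* n ∸ p) ℕ.+ (2 ℕ.* n ∸ q) ℕ.+ 2 ℕ.* ∣ d ∣
          ≤⟨ ℕ.+-mono-≤ (ℕ.+-mono-≤ (ℕ.m∸n≤m (2 ℕ.* n) p) (ℕ.≤-reflexive (ℕ.m≤n⇒m∸n≡0 q≥))) (ℕ.*-monoʳ-≤ 2 d≤n) ⟩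
        2 ℕ.* n ℕ.+ 0 ℕ.+ 2 ℕ.* n  ≡⟨ cong (ℕ._+ 2 ℕ.* n) (ℕ.+-identityʳ (2 ℕ.* n)) ⟩
        2 ℕ.* n ℕ.+ 2 ℕ.* n  ≡⟨ four n ⟩
        4 ℕ.* n ∎
      ... | inj₁ p≤ | inj₁ q≤ = begin
        (2 ℕ.* n ∸ p) ℕ.+ (2 ℕ.* n ∸ q) ℕ.+ 2 ℕ.* ∣ d ∣
          ≤⟨ ℕ.+-monoʳ-≤ ((2 ℕ.* n ∸ p) ℕ.+ (2 ℕ.* n ∸ q)) (ℕ.≤-trans (ℕ.≤-reflexive (twice ∣ d ∣)) d≤pq) ⟩
        (2 ℕ.* n ∸ p) ℕ.+ (2 ℕ.* n ∸ q) ℕ.+ (p ℕ.+ q)  ≡⟨ split (2 ℕ.* n ∸ p) _ p q ⟩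
        (2 ℕ.* n ∸ p ℕ.+ p) ℕ.+ (2 ℕ.* n ∸ q ℕ.+ q)  ≡⟨ cong₂ ℕ._+_ (ℕ.m∸n+n≡m p≤) (ℕ.m∸n+n≡m q≤) ⟩
        2 ℕ.* n ℕ.+ 2 ℕ.* n  ≡⟨ four n ⟩
        4 ℕ.* n ∎

    -- The eight terms form four pairs differing in the sign of d. The bound is attained at a = b =
    -- c = 0.
    planes-≤ : ∀ a b c d → ∣ d ∣ ℕ.≤ n → planes n a b c d ℕ.+ 8 ℕ.* ∣ d ∣ ℕ.≤ 16 ℕ.* n
    planes-≤ a b c d d≤n = begin
      planes n a b c d ℕ.+ 8 ℕ.* ∣ d ∣
        ≡⟨ regroup (T₁ d (a + b + c)) (T₁ d (a + b - c)) (T₁ d (a - b + c)) (T₁ d (a - b - c)) ∣ d ∣ ⟩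
      (T₁ d (a + b + c) ℕ.+ 2 ℕ.* ∣ d ∣) ℕ.+ (T₁ d (a + b - c) ℕ.+ 2 ℕ.* ∣ d ∣) ℕ.+
      ((T₁ d (a - b + c) ℕ.+ 2 ℕ.* ∣ d ∣) ℕ.+ (T₁ d (a - b - c) ℕ.+ 2 ℕ.* ∣ d ∣))
        ≤⟨ ℕ.+-mono-≤ (ℕ.+-mono-≤ (pair (a + b + c)) (pair (a + b - c)))
                      (ℕ.+-mono-≤ (pair (a - b + c)) (pair (a - b - c))) ⟩
      4 ℕ.* n ℕ.+ 4 ℕ.* n ℕ.+ (4 ℕ.* n ℕ.+ 4 ℕ.* n)  ≡⟨ sixteen n ⟩
      16 ℕ.* n ∎
      where
      open ℕ.≤-Reasoning
      pair = tent-pair-≤ d d≤n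
      sixteen : ∀ n → 4 ℕ.* n ℕ.+ 4 ℕ.* n ℕ.+ (4 ℕ.* n ℕ.+ 4 ℕ.* n) ≡ 16 ℕ.* n
      sixteen = ℕ-Solver.solve-∀
      regroup : ∀ p q r s d → p ℕ.+ q ℕ.+ (r ℕ.+ s) ℕ.+ 8 ℕ.* d ≡
                (p ℕ.+ 2 ℕ.* d) ℕ.+ (q ℕ.+ 2 ℕ.* d) ℕ.+ ((r ℕ.+ 2 ℕ.* d) ℕ.+ (s ℕ.+ 2 ℕ.* d))
      regroup = ℕ-Solver.solve-∀

    -- Cutting off at 0 only increases a tent, so the linear estimate is valid without a case
    -- distinction.
    tent-pair-≥ : ∀ u d {m} → ∣ u ∣ ℕ.≤ m → ∣ d ∣ ℕ.≤ m → 4 ℕ.* n ℕ.≤ spread d (tent n) u ℕ.+ (m ℕ.+ m)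
    tent-pair-≥ u d {m} u≤m d≤m = begin
      4 ℕ.* n                          ≡⟨ four n ⟩
      2 ℕ.* n ℕ.+ 2 ℕ.* n              ≤⟨ ℕ.+-mono-≤ (tent-above (u + d)) (tent-above (u - d)) ⟩
      (∣ u + d ∣ ℕ.+ tent n (u + d)) ℕ.+ (∣ u - d ∣ ℕ.+ tent n (u - d))
                                       ≡⟨ regroup (∣ u + d ∣) _ (∣ u - d ∣) _ ⟩
      spread d (tent n) u ℕ.+ (∣ u + d ∣ ℕ.+ ∣ u - d ∣)
                                       ≤⟨ ℕ.+-monoʳ-≤ (spread d (tent n) u) (∣+∣+∣-∣≤ u d u≤m d≤m) ⟩
      spread d (tent n) u ℕ.+ (m ℕ.+ m) ∎
      where
      open ℕ.≤-Reasoning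
      tent-above : ∀ t → 2 ℕ.* n ℕ.≤ ∣ t ∣ ℕ.+ tent n t
      tent-above t = ℕ.m≤n+m∸n (2 ℕ.* n) ∣ t ∣
      four : ∀ n → 4 ℕ.* n ≡ 2 ℕ.* n ℕ.+ 2 ℕ.* n
      four = ℕ-Solver.solve-∀
      regroup : ∀ p q r s → (p ℕ.+ q) ℕ.+ (r ℕ.+ s) ≡ (q ℕ.+ s) ℕ.+ (p ℕ.+ r)
      regroup = ℕ-Solver.solve-∀

    private
      Bound : ℕ → ℕ → ℕ → ℕ → Set
      Bound a b c d = 6 ℕ.* n ℕ.≤ planes n (+ a) (+ b) (+ c) (+ d)

      -- Dropping the two terms ±(a + b + c ± d), which may be truncated, loses nothing at the
      -- minimum; the other six pair up with ∣u + d∣ + ∣u − d∣ = 2 max(∣u∣, d).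
      bound-sorted : ∀ {a b c d} → b ℕ.≤ a → c ℕ.≤ a → d ℕ.≤ b → d ℕ.≤ c → a ℕ.≤ n → Bound a b c d
      bound-sorted {a} {b} {c} {d} b≤a c≤a d≤b d≤c a≤n = ℕ.+-cancelʳ-≤ (6 ℕ.* n) _ _ (begin
        6 ℕ.* n ℕ.+ 6 ℕ.* n  ≡⟨ twelve n ⟩
        4 ℕ.* n ℕ.+ 4 ℕ.* n ℕ.+ 4 ℕ.* n
          ≤⟨ ℕ.+-mono-≤ (ℕ.+-mono-≤
               (tent-pair-≥ u₂ (+ d) ∣u₂∣≤ (ℕ.≤-trans d≤b (ℕ.m≤m+n b e)))
               (tent-pair-≥ u₃ (+ d) ∣u₃∣≤ (ℕ.≤-trans d≤c (ℕ.m≤m+n c f))))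
               (tent-pair-≥ u₄ (+ d) ∣u₄∣≤ (ℕ.≤-trans d≤b (ℕ.≤-trans b≤a a≤n))) ⟩
        (T₁ (+ d) u₂ ℕ.+ (b ℕ.+ e ℕ.+ (b ℕ.+ e))) ℕ.+ (T₁ (+ d) u₃ ℕ.+ (c ℕ.+ f ℕ.+ (c ℕ.+ f))) ℕ.+
          (T₁ (+ d) u₄ ℕ.+ (n ℕ.+ n))
          -- The bounds `b + e` and `c + f` of the first two pairs are recombined crosswise: `e + c`
          -- and `f + b` both equal a ≤ n. So the three pairs lose at most 2n each, 6n in total.
          ≡⟨ regroup (T₁ (+ d) u₂) (T₁ (+ d) u₃) (T₁ (+ d) u₄) b c e f n ⟩
        T₁ (+ d) u₂ ℕ.+ (T₁ (+ d) u₃ ℕ.+ T₁ (+ d) u₄) ℕ.+ (2 ℕ.* (e ℕ.+ c) ℕ.+ 2 ℕ.* (f ℕ.+ b) ℕ.+ 2 ℕ.* n)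
          ≤⟨ ℕ.+-mono-≤ (ℕ.+-monoˡ-≤ _ (ℕ.m≤n+m (T₁ (+ d) u₂) (T₁ (+ d) (+ a + + b + + c))))
               (ℕ.+-monoˡ-≤ (2 ℕ.* n) (ℕ.+-mono-≤
                  (ℕ.*-monoʳ-≤ 2 (ℕ.≤-trans (ℕ.≤-reflexive (ℕ.m∸n+n≡m c≤a)) a≤n))
                  (ℕ.*-monoʳ-≤ 2 (ℕ.≤-trans (ℕ.≤-reflexive (ℕ.m∸n+n≡m b≤a)) a≤n)))) ⟩
        planes n (+ a) (+ b) (+ c) (+ d) ℕ.+ (2 ℕ.* n ℕ.+ 2 ℕ.* n ℕ.+ 2 ℕ.* n)
          ≡⟨ cong (ℕ._+_ (planes n (+ a) (+ b) (+ c) (+ d))) (six n) ⟩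
        planes n (+ a) (+ b) (+ c) (+ d) ℕ.+ 6 ℕ.* n ∎)
        where
        open ℕ.≤-Reasoning
        e = a ∸ c
        f = a ∸ b
        u₂ = + a + + b - + c
        u₃ = + a - + b + + c
        u₄ = + a - + b - + c
        e≡ : + e ≡ + a - + c
        e≡ = trans (sym (ℤ.⊖-≥ c≤a)) (sym (ℤ.[+m]-[+n]≡m⊖n a c))
        f≡ : + f ≡ + a - + b
        f≡ = trans (sym (ℤ.⊖-≥ b≤a)) (sym (ℤ.[+m]-[+n]≡m⊖n a b))
        shuffle : ∀ a b c → a + b - c ≡ b + (a - c)
        shuffle = ℤ-Solver.solve-∀
        ∣u₂∣≤ : ∣ u₂ ∣ ℕ.≤ b ℕ.+ e
        ∣u₂∣≤ = ℕ.≤-reflexive (cong ∣_∣ (trans (shuffle (+ a) (+ b) (+ c)) (cong (_+_ (+ b)) (sym e≡))))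
        ∣u₃∣≤ : ∣ u₃ ∣ ℕ.≤ c ℕ.+ f
        ∣u₃∣≤ = ℕ.≤-reflexive (cong ∣_∣ (trans (ℤ.+-comm (+ a - + b) (+ c)) (cong (_+_ (+ c)) (sym f≡))))
        ∣u₄∣≤ : ∣ u₄ ∣ ℕ.≤ n
        ∣u₄∣≤ = ℕ.≤-trans
          (ℕ.≤-reflexive (cong ∣_∣ (trans (cong (_- + c) (sym f≡)) (ℤ.[+m]-[+n]≡m⊖n f c))))
          (ℕ.≤-trans (ℤ.∣m⊝n∣≤m⊔n f c) (ℕ.⊔-lub (ℕ.≤-trans (ℕ.m∸n≤m a b) a≤n) (ℕ.≤-trans c≤a a≤n)))
        twelve : ∀ n → 6 ℕ.* n ℕ.+ 6 ℕ.* n ≡ 4 ℕ.* n ℕ.+ 4 ℕ.* n ℕ.+ 4 ℕ.* n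
        twelve = ℕ-Solver.solve-∀
        six : ∀ n → 2 ℕ.* n ℕ.+ 2 ℕ.* n ℕ.+ 2 ℕ.* n ≡ 6 ℕ.* n
        six = ℕ-Solver.solve-∀
        regroup : ∀ p q r b c e f n →
          (p ℕ.+ (b ℕ.+ e ℕ.+ (b ℕ.+ e))) ℕ.+ (q ℕ.+ (c ℕ.+ f ℕ.+ (c ℕ.+ f))) ℕ.+ (r ℕ.+ (n ℕ.+ n)) ≡
          p ℕ.+ (q ℕ.+ r) ℕ.+ (2 ℕ.* (e ℕ.+ c) ℕ.+ 2 ℕ.* (f ℕ.+ b) ℕ.+ 2 ℕ.* n)
        regroup = ℕ-Solver.solve-∀

      swap₁ : ∀ a b c d → Bound a b c d → Bound b a c d
      swap₁ a b c d = subst (6 ℕ.* n ℕ.≤_) (planes-swap₁ (+ a) (+ b) (+ c) (+ d))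

      swap₂ : ∀ a b c d → Bound a b c d → Bound a c b d
      swap₂ a b c d = subst (6 ℕ.* n ℕ.≤_) (planes-swap₂ (+ a) (+ b) (+ c) (+ d))

      swap₃ : ∀ a b c d → Bound a b c d → Bound a b d c
      swap₃ a b c d = subst (6 ℕ.* n ℕ.≤_) (planes-swap₃ (+ a) (+ b) (+ c) (+ d))

      -- `bound-sorted` asks only for the largest entry in front and the smallest at the end; the
      -- middle two may be in either order. Here the largest is brought to the front, and the lemmas
      -- that follow carry the smallest to the end, one comparison at a time.
      bound-min₄ : ∀ a b c d → a ℕ.≤ n → b ℕ.≤ n → c ℕ.≤ n →
                   d ℕ.≤ a → d ℕ.≤ b → d ℕ.≤ c → Bound a b c d
      bound-min₄ a b c d a≤n b≤n c≤n d≤a d≤b d≤c with ℕ.≤-total b a | ℕ.≤-total c a | ℕ.≤-total c b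
      ... | inj₁ b≤a | inj₁ c≤a | _        = bound-sorted b≤a c≤a d≤b d≤c a≤n
      ... | inj₁ b≤a | inj₂ a≤c | _        = swap₁ b a c d (swap₂ b c a d (swap₁ c b a d
                                               (bound-sorted (ℕ.≤-trans b≤a a≤c) a≤c d≤b d≤a c≤n)))
      ... | inj₂ a≤b | _        | inj₁ c≤b = swap₁ b a c d (bound-sorted a≤b c≤b d≤a d≤c b≤n)
      ... | inj₂ a≤b | _        | inj₂ b≤c = swap₁ b a c d (swap₂ b c a d (swap₁ c b a d
                                               (bound-sorted b≤c (ℕ.≤-trans a≤b b≤c) d≤b d≤a c≤n)))

      bound-min₃ : ∀ a b c d → a ℕ.≤ n → b ℕ.≤ n → c ℕ.≤ n → d ℕ.≤ n →
                   c ℕ.≤ a → c ℕ.≤ b → Bound a b c d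
      bound-min₃ a b c d a≤n b≤n c≤n d≤n c≤a c≤b with ℕ.≤-total c d
      ... | inj₁ c≤d = swap₃ a b d c (bound-min₄ a b d c a≤n b≤n d≤n c≤a c≤b c≤d)
      ... | inj₂ d≤c = bound-min₄ a b c d a≤n b≤n c≤n (ℕ.≤-trans d≤c c≤a) (ℕ.≤-trans d≤c c≤b) d≤c

      bound-min₂ : ∀ a b c d → a ℕ.≤ n → b ℕ.≤ n → c ℕ.≤ n → d ℕ.≤ n → b ℕ.≤ a → Bound a b c d
      bound-min₂ a b c d a≤n b≤n c≤n d≤n b≤a with ℕ.≤-total b c
      ... | inj₁ b≤c = swap₂ a c b d (bound-min₃ a c b d a≤n c≤n b≤n d≤n b≤a b≤c)
      ... | inj₂ c≤b = bound-min₃ a b c d a≤n b≤n c≤n d≤n (ℕ.≤-trans c≤b b≤a) c≤b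

      bound : ∀ a b c d → a ℕ.≤ n → b ℕ.≤ n → c ℕ.≤ n → d ℕ.≤ n → Bound a b c d
      bound a b c d a≤n b≤n c≤n d≤n with ℕ.≤-total a b
      ... | inj₁ a≤b = swap₁ b a c d (bound-min₂ b a c d b≤n a≤n c≤n d≤n a≤b)
      ... | inj₂ b≤a = bound-min₂ a b c d a≤n b≤n c≤n d≤n b≤a

    planes-≥ : ∀ a b c d → ∣ a ∣ ℕ.≤ n → ∣ b ∣ ℕ.≤ n → ∣ c ∣ ℕ.≤ n → ∣ d ∣ ℕ.≤ n →
               6 ℕ.* n ℕ.≤ planes n a b c d
    planes-≥ a b c d a≤n b≤n c≤n d≤n = subst (6 ℕ.* n ℕ.≤_) (planes-∣∣ a b c d)
      (bound (∣ a ∣) (∣ b ∣) (∣ c ∣) (∣ d ∣) a≤n b≤n c≤n d≤n)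

-- Bishop incidences in centred coordinates

module Counting where
  open import Data.Fin.Base using (Fin; zero; suc; toℕ; fromℕ; inject₁; opposite)
  import Data.Fin.Properties as Fin
  open import Data.Integer.Base as ℤ using (ℤ; +_; 0ℤ; 1ℤ; ∣_∣; _+_; _-_; -_)
  import Data.Integer.Properties as ℤ
  import Data.Integer.Tactic.RingSolver as ℤ-Solver
  open import Data.Nat.Base as ℕ using (ℕ; zero; suc; _∸_)
  import Data.Nat.Properties as ℕ
  import Data.Nat.Tactic.RingSolver as ℕ-Solver
  open import Data.Product.Base using (_,_)
  open import Relation.Binary.PropositionalEquality
  open import Relation.Nullary
  open Summation
  open Tent

  -- Reflecting the coordinate negates this value. Doubling keeps it integral when the middle of the
  -- board lies between two cells.
  centre : ∀ {n} → Fin n → ℤ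
  centre x = + toℕ x - + toℕ (opposite x)

  toℕ-opposite : ∀ {n} (x : Fin n) → + toℕ (opposite x) ≡ + n - 1ℤ - + toℕ x
  toℕ-opposite {n} x = begin
    + toℕ (opposite x)         ≡⟨ cong +_ (Fin.opposite-prop x) ⟩
    + (n ∸ suc (toℕ x))        ≡⟨ ℤ.⊖-≥ (Fin.toℕ<n x) ⟨
    n ℤ.⊖ suc (toℕ x)          ≡⟨ ℤ.[+m]-[+n]≡m⊖n n (suc (toℕ x)) ⟨
    + n - (1ℤ + + toℕ x)       ≡⟨ eq (+ n) (+ toℕ x) ⟩
    + n - 1ℤ - + toℕ x         ∎
    where
    open ≡-Reasoning
    eq : ∀ n x → n - (1ℤ + x) ≡ n - 1ℤ - x
    eq = ℤ-Solver.solve-∀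

  centre≡ : ∀ {n} (x : Fin n) → centre x ≡ + toℕ x - (+ n - 1ℤ - + toℕ x)
  centre≡ x = cong (_-_ (+ toℕ x)) (toℕ-opposite x)

  centre-opposite : ∀ {n} (x : Fin n) → centre (opposite x) ≡ - centre x
  centre-opposite x = trans
    (cong (λ y → + toℕ (opposite x) - + toℕ y) (Fin.opposite-involutive x))
    (eq (+ toℕ (opposite x)) (+ toℕ x))
    where
    eq : ∀ a b → a - b ≡ - (b - a)
    eq = ℤ-Solver.solve-∀

  ∣centre∣≤n : ∀ {n} (x : Fin n) → ∣ centre x ∣ ℕ.≤ n
  ∣centre∣≤n x = ℕ.≤-trans
    (ℕ.≤-reflexive (cong ∣_∣ (ℤ.[+m]-[+n]≡m⊖n (toℕ x) (toℕ (opposite x)))))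
    (ℕ.≤-trans (ℤ.∣m⊝n∣≤m⊔n (toℕ x) (toℕ (opposite x)))
      (ℕ.⊔-lub (Fin.toℕ≤n x) (Fin.toℕ≤n (opposite x))))

  -- Induction in steps of two: without its two outermost cells a row of length n + 2 is a row of
  -- length n with the same centred coordinates, and the two removed cells contribute n + 1 each.
  -- The slack 1 is attained for odd n.
  sum-∣centre∣ : ∀ n → n ℕ.* n ℕ.≤ 2 ℕ.* sum {n} (λ x → ∣ centre x ∣) ℕ.+ 1
  sum-∣centre∣ zero          = ℕ.z≤n
  sum-∣centre∣ (suc zero)    = ℕ.s≤s ℕ.z≤n
  sum-∣centre∣ (suc (suc n)) = begin
    suc (suc n) ℕ.* suc (suc n)             ≡⟨ eq₁ n ⟩
    n ℕ.* n ℕ.+ 4 ℕ.* suc n                 ≤⟨ ℕ.+-monoˡ-≤ (4 ℕ.* suc n) (sum-∣centre∣ n) ⟩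
    2 ℕ.* Σ ℕ.+ 1 ℕ.+ 4 ℕ.* suc n           ≡⟨ eq₂ Σ n ⟩
    2 ℕ.* (suc n ℕ.+ (Σ ℕ.+ suc n)) ℕ.+ 1   ≡⟨ cong (λ s → 2 ℕ.* s ℕ.+ 1) peel ⟨
    2 ℕ.* sum {suc (suc n)} (λ x → ∣ centre x ∣) ℕ.+ 1 ∎
    where
    open ℕ.≤-Reasoning
    Σ = sum {n} (λ x → ∣ centre x ∣)
    eq₁ : ∀ n → suc (suc n) ℕ.* suc (suc n) ≡ n ℕ.* n ℕ.+ 4 ℕ.* suc n
    eq₁ = ℕ-Solver.solve-∀
    eq₂ : ∀ s n → 2 ℕ.* s ℕ.+ 1 ℕ.+ 4 ℕ.* suc n ≡ 2 ℕ.* (suc n ℕ.+ (s ℕ.+ suc n)) ℕ.+ 1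
    eq₂ = ℕ-Solver.solve-∀
    first : ∣ centre {suc (suc n)} zero ∣ ≡ suc n
    first = cong ∣_∣ (trans (centre≡ {suc (suc n)} zero) (e (+ n)))
      where
      e : ∀ n → 0ℤ - (+ 2 + n - 1ℤ - 0ℤ) ≡ - (1ℤ + n)
      e = ℤ-Solver.solve-∀
    final : ∣ centre {suc (suc n)} (suc (fromℕ n)) ∣ ≡ suc n
    final = cong ∣_∣ (trans (centre≡ {suc (suc n)} (suc (fromℕ n)))
      (trans (cong (λ k → + suc k - (+ suc (suc n) - 1ℤ - + suc k)) (Fin.toℕ-fromℕ n)) (e (+ n))))
      where
      e : ∀ n → (1ℤ + n) - (+ 2 + n - 1ℤ - (1ℤ + n)) ≡ 1ℤ + n
      e = ℤ-Solver.solve-∀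
    middle : ∀ x → centre {suc (suc n)} (suc (inject₁ x)) ≡ centre {n} x
    middle x = trans (centre≡ {suc (suc n)} (suc (inject₁ x)))
      (trans (cong (λ k → + suc k - (+ suc (suc n) - 1ℤ - + suc k)) (Fin.toℕ-inject₁ x))
      (trans (e (+ n) (+ toℕ x)) (sym (centre≡ x))))
      where
      e : ∀ n x → (1ℤ + x) - (+ 2 + n - 1ℤ - (1ℤ + x)) ≡ x - (n - 1ℤ - x)
      e = ℤ-Solver.solve-∀
    peel : sum {suc (suc n)} (λ x → ∣ centre x ∣) ≡ suc n ℕ.+ (Σ ℕ.+ suc n)
    peel = cong₂ ℕ._+_ first (trans (sum-init-last {n} (λ x → ∣ centre {suc (suc n)} (suc x) ∣))
      (cong₂ ℕ._+_ (sum-cong-≗ {n} (λ x → cong ∣_∣ (middle x))) final))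

  module _ {n : ℕ} where

    private
      ∑² : (Fin n → Fin n → ℕ) → ℕ
      ∑² f = sum (λ a → sum (f a))

      ∑²-cong : ∀ {f g} → (∀ a b → f a b ≡ g a b) → ∑² f ≡ ∑² g
      ∑²-cong f≗g = sum-cong-≗ (λ a → sum-cong-≗ (f≗g a))

      ∑²-+ : ∀ f g → ∑² (λ a b → f a b ℕ.+ g a b) ≡ ∑² f ℕ.+ ∑² g
      ∑²-+ f g = trans (sum-cong-≗ (λ a → ∑-distrib-+ (f a) (g a)))
                       (∑-distrib-+ (λ a → sum (f a)) (λ a → sum (g a)))

      diagonal : ∀ {P : Fin n → Fin n → Set} (P? : ∀ a b → Dec (P a b)) k →
                 (∀ a b → P a b → k ≡ + toℕ a - + toℕ b) →
                 (∀ a b → k ≡ + toℕ a - + toℕ b → P a b) →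
                 2 ℕ.* ∑² (λ a b → 𝟙 (P? a b)) ≡ tent n (k + k)
      diagonal P? k to from = begin
        2 ℕ.* ∑² (λ a b → 𝟙 (P? a b))
          ≡⟨ cong (ℕ._*_ 2) (∑²-cong (λ a b →
               𝟙-cong (P? a b) ((+ toℕ a - + toℕ b) ℤ.≟ k)
                      (λ p → sym (to a b p)) (λ e → from a b (sym e)))) ⟩
        2 ℕ.* ∑² (λ a b → 𝟙 ((+ toℕ a - + toℕ b) ℤ.≟ k))
                                ≡⟨ cong (ℕ._*_ 2) (diagonal-count n k) ⟩
        2 ℕ.* (n ∸ ∣ k ∣)       ≡⟨ ℕ.*-distribˡ-∸ 2 n ∣ k ∣ ⟩
        2 ℕ.* n ∸ 2 ℕ.* ∣ k ∣   ≡⟨ cong (2 ℕ.* n ∸_) (ℤ.∣i*j∣≡∣i∣*∣j∣ (+ 2) k) ⟨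
        tent n (+ 2 ℤ.* k)      ≡⟨ cong (tent n) (double k) ⟩
        tent n (k + k)          ∎
        where
        open ≡-Reasoning
        double : ∀ k → + 2 ℤ.* k ≡ k + k
        double = ℤ-Solver.solve-∀

      via : ∀ {i j e} → e ≡ i - j → e ≡ 0ℤ → i ≡ j
      via {i} {j} eq e≡0 = ℤ.i-j≡0⇒i≡j i j (trans (sym eq) e≡0)

      via⁻ : ∀ {i j e} → e ≡ i - j → i ≡ j → e ≡ 0ℤ
      via⁻ {i} {j} eq i≡j = trans eq (ℤ.i≡j⇒i-j≡0 i≡j)

    minus-count : ∀ (x y : Fin n) r → 2 ℕ.* ∑² (λ a b → 𝟙 (diff x a - diff y b + r ℤ.≟ 0ℤ)) ≡
                                      tent n (centre x - centre y + (r + r))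
    minus-count x y r = trans
      (diagonal (λ a b → diff x a - diff y b + r ℤ.≟ 0ℤ) (+ toℕ x - + toℕ y + r)
        (λ a b → via (eq (+ toℕ x) (+ toℕ y) (+ toℕ a) (+ toℕ b) r))
        (λ a b → via⁻ (eq (+ toℕ x) (+ toℕ y) (+ toℕ a) (+ toℕ b) r)))
      (cong (tent n) (trans (double (+ toℕ x) (+ toℕ y) r (+ n))
        (sym (cong₂ (λ u v → u - v + (r + r)) (centre≡ x) (centre≡ y)))))
      where
      eq : ∀ x y a b r → x - a - (y - b) + r ≡ (x - y + r) - (a - b)
      eq = ℤ-Solver.solve-∀
      double : ∀ x y r n → x - y + r + (x - y + r) ≡ x - (n - 1ℤ - x) - (y - (n - 1ℤ - y)) + (r + r)
      double = ℤ-Solver.solve-∀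

    -- Reversing the second coordinate turns the antidiagonal a + b = const into a diagonal, and the
    -- count proceeds as in `minus-count`.
    plus-count : ∀ (x y : Fin n) r → 2 ℕ.* ∑² (λ a b → 𝟙 (diff x a + diff y b + r ℤ.≟ 0ℤ)) ≡
                                     tent n (centre x + centre y + (r + r))
    plus-count x y r = trans
      (cong (ℕ._*_ 2) (sum-cong-≗ (λ a → sum-reverse (λ b → 𝟙 (diff x a + diff y b + r ℤ.≟ 0ℤ)))))
      (trans
      (diagonal (λ a b → diff x a + diff y (opposite b) + r ℤ.≟ 0ℤ)
        (+ toℕ x - (+ n - 1ℤ - + toℕ y) + r)
        (λ a b → via (eq a b)) (λ a b → via⁻ (eq a b)))
      (cong (tent n) (trans (double (+ toℕ x) (+ toℕ y) r (+ n))
        (sym (cong₂ (λ u v → u + v + (r + r)) (centre≡ x) (centre≡ y))))))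
      where
      solved : ∀ x y a b r n → x - a + (y - (n - 1ℤ - b)) + r ≡ (x - (n - 1ℤ - y) + r) - (a - b)
      solved = ℤ-Solver.solve-∀
      eq : ∀ a b → diff x a + diff y (opposite b) + r ≡
                   (+ toℕ x - (+ n - 1ℤ - + toℕ y) + r) - (+ toℕ a - + toℕ b)
      eq a b = trans (cong (λ o → diff x a + (+ toℕ y - o) + r) (toℕ-opposite b))
                     (solved (+ toℕ x) (+ toℕ y) (+ toℕ a) (+ toℕ b) r (+ n))
      double : ∀ x y r n → x - (n - 1ℤ - y) + r + (x - (n - 1ℤ - y) + r) ≡
                           x - (n - 1ℤ - x) + (y - (n - 1ℤ - y)) + (r + r)
      double = ℤ-Solver.solve-∀

    -- Incidences are counted with multiplicity: a space on several bishop planes through x counts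
    -- once for each. That makes the total a plain sum over the planes; the overcount is repaid in
    -- `queen≥`.
    bishops : (x a : Space n) → ℕ
    bishops (x , y , z) (a , b , c) =
      𝟙 (diff x a + diff y b + diff z c ℤ.≟ 0ℤ) ℕ.+ (𝟙 (diff x a + diff y b - diff z c ℤ.≟ 0ℤ) ℕ.+
      (𝟙 (diff x a - diff y b + diff z c ℤ.≟ 0ℤ) ℕ.+ 𝟙 (diff x a - diff y b - diff z c ℤ.≟ 0ℤ)))

    bishopTotal : Space n → ℕ
    bishopTotal x = sum (λ a → sum (λ b → sum (λ c → bishops x (a , b , c))))

    -- Twice the number of bishop incidences in the layer of the board at centred height t.
    layer : (x : Space n) → ℤ → ℕ
    layer (x , y , z) t =
      tent n (X + Y + Z - t) ℕ.+ (tent n (X + Y - Z + t) ℕ.+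
      (tent n (X - Y + Z - t) ℕ.+ tent n (X - Y - Z + t)))
      where X = centre x ; Y = centre y ; Z = centre z

    layer-count : ∀ x c → 2 ℕ.* ∑² (λ a b → bishops x (a , b , c)) ≡ layer x (centre c)
    layer-count (x , y , z) c = begin
      2 ℕ.* ∑² (λ a b → p₁ a b ℕ.+ (p₂ a b ℕ.+ (p₃ a b ℕ.+ p₄ a b)))
        ≡⟨ cong (ℕ._*_ 2) (trans (∑²-+ p₁ _) (cong (ℕ._+_ (∑² p₁))
             (trans (∑²-+ p₂ _) (cong (ℕ._+_ (∑² p₂)) (∑²-+ p₃ p₄))))) ⟩
      2 ℕ.* (∑² p₁ ℕ.+ (∑² p₂ ℕ.+ (∑² p₃ ℕ.+ ∑² p₄)))
        ≡⟨ distrib (∑² p₁) (∑² p₂) (∑² p₃) (∑² p₄) ⟩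
      2 ℕ.* ∑² p₁ ℕ.+ (2 ℕ.* ∑² p₂ ℕ.+ (2 ℕ.* ∑² p₃ ℕ.+ 2 ℕ.* ∑² p₄))
        ≡⟨ cong₂ ℕ._+_ (trans (plus-count x y r) (cong (tent n) (up (X + Y))))
          (cong₂ ℕ._+_ (trans (plus-count x y (- r)) (cong (tent n) (down (X + Y))))
          (cong₂ ℕ._+_ (trans (minus-count x y r) (cong (tent n) (up (X - Y))))
                       (trans (minus-count x y (- r)) (cong (tent n) (down (X - Y)))))) ⟩
      layer (x , y , z) (centre c) ∎
      where
      open ≡-Reasoning
      r = diff z c
      X = centre x
      Y = centre y
      p₁ = λ a b → 𝟙 (diff x a + diff y b + r ℤ.≟ 0ℤ)
      p₂ = λ a b → 𝟙 (diff x a + diff y b - r ℤ.≟ 0ℤ)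
      p₃ = λ a b → 𝟙 (diff x a - diff y b + r ℤ.≟ 0ℤ)
      p₄ = λ a b → 𝟙 (diff x a - diff y b - r ℤ.≟ 0ℤ)
      distrib : ∀ p q r s → 2 ℕ.* (p ℕ.+ (q ℕ.+ (r ℕ.+ s))) ≡
                            2 ℕ.* p ℕ.+ (2 ℕ.* q ℕ.+ (2 ℕ.* r ℕ.+ 2 ℕ.* s))
      distrib = ℕ-Solver.solve-∀
      solve-up : ∀ t z c n → t + (z - c + (z - c)) ≡ t + (z - (n - 1ℤ - z)) - (c - (n - 1ℤ - c))
      solve-up = ℤ-Solver.solve-∀
      solve-down : ∀ t z c n → t + (- (z - c) + - (z - c)) ≡ t - (z - (n - 1ℤ - z)) + (c - (n - 1ℤ - c))
      solve-down = ℤ-Solver.solve-∀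
      up : ∀ t → t + (r + r) ≡ t + centre z - centre c
      up t = trans (solve-up t (+ toℕ z) (+ toℕ c) (+ n))
                   (sym (cong₂ (λ u v → t + u - v) (centre≡ z) (centre≡ c)))
      down : ∀ t → t + (- r + - r) ≡ t - centre z + centre c
      down t = trans (solve-down t (+ toℕ z) (+ toℕ c) (+ n))
                     (sym (cong₂ (λ u v → t - u + v) (centre≡ z) (centre≡ c)))

    -- Pairing each layer with its mirror image completes the eight sign patterns.
    bishopTotal≡ : ∀ x y z → 4 ℕ.* bishopTotal (x , y , z) ≡
                   sum {n} (λ c → planes n (centre x) (centre y) (centre z) (centre c))
    bishopTotal≡ x y z = begin
      4 ℕ.* bishopTotal s
        -- The sum over c is moved outermost, so that what is summed are horizontal layers.
        ≡⟨ cong (ℕ._*_ 4) (trans (sum-cong-≗ (λ a → ∑-comm (λ b c → bishops s (a , b , c))))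
                                 (∑-comm (λ a c → sum (λ b → bishops s (a , b , c))))) ⟩
      4 ℕ.* sum slice                         ≡⟨ four (sum slice) ⟩
      2 ℕ.* sum slice ℕ.+ 2 ℕ.* sum slice     ≡⟨ cong₂ ℕ._+_ layers (trans layers (sum-reverse lay)) ⟩
      sum lay ℕ.+ sum (λ c → lay (opposite c))
        ≡⟨ ∑-distrib-+ lay (λ c → lay (opposite c)) ⟨
      sum (λ c → lay c ℕ.+ lay (opposite c))
        ≡⟨ sum-cong-≗ (λ c → trans (cong (λ t → lay c ℕ.+ layer s t) (centre-opposite c))
                                   (mirror (centre c))) ⟩
      sum {n} (λ c → planes n X Y Z (centre c))   ∎
      where
      open ≡-Reasoning
      s = x , y , z
      X = centre x
      Y = centre y
      Z = centre z
      slice lay : Fin n → ℕ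
      slice c = ∑² (λ a b → bishops s (a , b , c))
      lay c = layer s (centre c)
      layers : 2 ℕ.* sum slice ≡ sum lay
      layers = trans (*-distribˡ-sum 2 slice) (sum-cong-≗ (layer-count s))
      four : ∀ k → 4 ℕ.* k ≡ 2 ℕ.* k ℕ.+ 2 ℕ.* k
      four = ℕ-Solver.solve-∀
      regroup : ∀ p q r s p′ q′ r′ s′ →
        p ℕ.+ (q ℕ.+ (r ℕ.+ s)) ℕ.+ (p′ ℕ.+ (q′ ℕ.+ (r′ ℕ.+ s′))) ≡
        (p′ ℕ.+ p) ℕ.+ (q ℕ.+ q′) ℕ.+ ((r′ ℕ.+ r) ℕ.+ (s ℕ.+ s′))
      regroup = ℕ-Solver.solve-∀
      neg : ∀ u t → u - - t ≡ u + t
      neg u t = cong (_+_ u) (ℤ.neg-involutive t)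
      mirror : ∀ t → layer s t ℕ.+ layer s (- t) ≡ planes n X Y Z t
      mirror t = trans
        (regroup (tent n (X + Y + Z - t)) (tent n (X + Y - Z + t))
                 (tent n (X - Y + Z - t)) (tent n (X - Y - Z + t))
                 (tent n (X + Y + Z - - t)) (tent n (X + Y - Z + - t))
                 (tent n (X - Y + Z - - t)) (tent n (X - Y - Z + - t)))
        (cong₂ (λ u v → (tent n u ℕ.+ tent n (X + Y + Z - t)) ℕ.+ spread t (tent n) (X + Y - Z) ℕ.+
                        ((tent n v ℕ.+ tent n (X - Y + Z - t)) ℕ.+ spread t (tent n) (X - Y - Z)))
               (neg (X + Y + Z) t) (neg (X - Y + Z) t))

    bishopTotal-≥ : ∀ x → 6 ℕ.* (n ℕ.* n) ℕ.≤ 4 ℕ.* bishopTotal x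
    bishopTotal-≥ (x , y , z) = begin
      6 ℕ.* (n ℕ.* n)      ≡⟨ eq n ⟩
      n ℕ.* (6 ℕ.* n)      ≡⟨ sum-const n (6 ℕ.* n) ⟨
      sum {n} (λ _ → 6 ℕ.* n)
        ≤⟨ sum-mono {n} (λ c → planes-≥ n (centre x) (centre y) (centre z) (centre c)
             (∣centre∣≤n x) (∣centre∣≤n y) (∣centre∣≤n z) (∣centre∣≤n c)) ⟩
      sum {n} (λ c → planes n (centre x) (centre y) (centre z) (centre c))
        ≡⟨ bishopTotal≡ x y z ⟨
      4 ℕ.* bishopTotal (x , y , z) ∎
      where
      open ℕ.≤-Reasoning
      eq : ∀ n → 6 ℕ.* (n ℕ.* n) ≡ n ℕ.* (6 ℕ.* n)
      eq = ℕ-Solver.solve-∀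

    -- Four times the total is at most 16n² - 8 Σ∣C∣ ≤ 16n² - 4(n² - 1) = 12n² + 4. To stay within
    -- ℕ, 4n² is added to both sides before cancelling. The final 1 is the parity slack of
    -- `sum-∣centre∣`.
    bishopTotal-≤ : ∀ x → bishopTotal x ℕ.≤ 3 ℕ.* (n ℕ.* n) ℕ.+ 1
    bishopTotal-≤ (x , y , z) = ℕ.*-cancelˡ-≤ 4 (ℕ.+-cancelʳ-≤ (4 ℕ.* (n ℕ.* n)) _ _ (begin
      4 ℕ.* bishopTotal (x , y , z) ℕ.+ 4 ℕ.* (n ℕ.* n)
        ≤⟨ ℕ.+-mono-≤ (ℕ.≤-reflexive (bishopTotal≡ x y z)) (ℕ.*-monoʳ-≤ 4 (sum-∣centre∣ n)) ⟩
      sum pl ℕ.+ 4 ℕ.* (2 ℕ.* sum dist ℕ.+ 1)      ≡⟨ eq₁ (sum pl) (sum dist) ⟩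
      (sum pl ℕ.+ 8 ℕ.* sum dist) ℕ.+ 4            ≡⟨ cong (ℕ._+ 4) merge ⟩
      sum (λ c → pl c ℕ.+ 8 ℕ.* dist c) ℕ.+ 4
        ≤⟨ ℕ.+-monoˡ-≤ 4 (sum-mono (λ c →
             planes-≤ n (centre x) (centre y) (centre z) (centre c) (∣centre∣≤n c))) ⟩
      sum {n} (λ _ → 16 ℕ.* n) ℕ.+ 4               ≡⟨ cong (ℕ._+ 4) (sum-const n (16 ℕ.* n)) ⟩
      n ℕ.* (16 ℕ.* n) ℕ.+ 4                       ≡⟨ eq₂ n ⟩
      4 ℕ.* (3 ℕ.* (n ℕ.* n) ℕ.+ 1) ℕ.+ 4 ℕ.* (n ℕ.* n) ∎))
      where
      open ℕ.≤-Reasoning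
      pl dist : Fin n → ℕ
      pl c = planes n (centre x) (centre y) (centre z) (centre c)
      dist c = ∣ centre c ∣
      merge : sum pl ℕ.+ 8 ℕ.* sum dist ≡ sum (λ c → pl c ℕ.+ 8 ℕ.* dist c)
      merge = trans (cong (ℕ._+_ (sum pl)) (*-distribˡ-sum 8 dist))
                    (sym (∑-distrib-+ pl (λ c → 8 ℕ.* dist c)))
      eq₁ : ∀ p s → p ℕ.+ 4 ℕ.* (2 ℕ.* s ℕ.+ 1) ≡ (p ℕ.+ 8 ℕ.* s) ℕ.+ 4
      eq₁ = ℕ-Solver.solve-∀
      eq₂ : ∀ n → n ℕ.* (16 ℕ.* n) ℕ.+ 4 ≡ 4 ℕ.* (3 ℕ.* (n ℕ.* n) ℕ.+ 1) ℕ.+ 4 ℕ.* (n ℕ.* n)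
      eq₂ = ℕ-Solver.solve-∀

-- The number of spaces attacking a given space

module Attacks where
  open import Data.Empty using (⊥)
  open import Data.Fin.Base using (Fin; toℕ)
  import Data.Fin.Properties as Fin
  open import Data.Integer.Base as ℤ using (ℤ; +_; 0ℤ)
  import Data.Integer.Properties as ℤ
  import Data.Integer.Tactic.RingSolver as ℤ-Solver
  import Algebra.Properties.AbelianGroup ℤ.+-0-abelianGroup as ℤ-Group
  open import Data.Nat.Base
  open import Data.Nat.Properties
  open import Data.Nat.Tactic.RingSolver using (solve-∀)
  open import Data.Product.Base using (_,_)
  open import Data.Sum.Base using (_⊎_; inj₁; inj₂)
  open import Relation.Binary.PropositionalEquality
  open import Relation.Nullary
  open Summation
  open Counting

  module _ {n : ℕ} where

    ∑³ : (Space n → ℕ) → ℕ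
    ∑³ f = sum (λ a → sum (λ b → sum (λ c → f (a , b , c))))

    ∑³-mono : ∀ {f g} → (∀ a → f a ≤ g a) → ∑³ f ≤ ∑³ g
    ∑³-mono f≤g = sum-mono (λ a → sum-mono (λ b → sum-mono (λ c → f≤g (a , b , c))))

    ∑³-cong : ∀ {f g} → (∀ a → f a ≡ g a) → ∑³ f ≡ ∑³ g
    ∑³-cong f≗g = sum-cong-≗ (λ a → sum-cong-≗ (λ b → sum-cong-≗ (λ c → f≗g (a , b , c))))

    ∑³-+ : ∀ f g → ∑³ (λ a → f a + g a) ≡ ∑³ f + ∑³ g
    ∑³-+ f g = trans
      (sum-cong-≗ (λ a → trans
        (sum-cong-≗ (λ b → ∑-distrib-+ (λ c → f (a , b , c)) (λ c → g (a , b , c))))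
        (∑-distrib-+ (λ b → sum (λ c → f (a , b , c))) (λ b → sum (λ c → g (a , b , c))))))
      (∑-distrib-+ (λ a → sum (λ b → sum (λ c → f (a , b , c))))
                   (λ a → sum (λ b → sum (λ c → g (a , b , c)))))

    sum-product : ∀ {m k} (f : Fin m → ℕ) (g : Fin k → ℕ) →
                  sum (λ a → sum (λ b → f a * g b)) ≡ sum f * sum g
    sum-product f g = trans (sum-cong-≗ (λ a → sym (*-distribˡ-sum (f a) g)))
                            (sym (*-distribʳ-sum (sum g) f))

    ∑³-product : ∀ (f g h : Fin n → ℕ) →
                 ∑³ (λ (a , b , c) → f a * (g b * h c)) ≡ sum f * (sum g * sum h)
    ∑³-product f g h = trans
      (sum-cong-≗ (λ a → trans
        (sum-cong-≗ (λ b → sym (*-distribˡ-sum (f a) (λ c → g b * h c))))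
        (trans (sym (*-distribˡ-sum (f a) (λ b → sum (λ c → g b * h c))))
               (cong (_*_ (f a)) (sum-product g h)))))
      (sym (*-distribʳ-sum (sum g * sum h) f))

    diff-injective : ∀ (x : Fin n) {a b} → diff x a ≡ diff x b → a ≡ b
    diff-injective x eq = Fin.toℕ-injective (ℤ.+-injective (ℤ.neg-injective (ℤ-Group.∙-cancelˡ (+ toℕ x) _ _ eq)))

    diff≡0⇒≡ : ∀ {x a : Fin n} → diff x a ≡ 0ℤ → x ≡ a
    diff≡0⇒≡ eq = Fin.toℕ-injective (ℤ.+-injective (ℤ.i-j≡0⇒i≡j _ _ eq))

    2*diff≡0⇒≡ : ∀ {x a : Fin n} → + 2 ℤ.* diff x a ≡ 0ℤ → x ≡ a
    2*diff≡0⇒≡ {x} {a} eq with ℤ.i*j≡0⇒i≡0∨j≡0 (+ 2) {diff x a} eq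
    ... | inj₂ diff≡0 = diff≡0⇒≡ {x} {a} diff≡0

    -- `collisions` is the pairwise term of inclusion and exclusion for the three rook planes. The
    -- triple term is left out, which errs in the direction that a lower bound on the union allows.
    file₁ file₂ file₃ rooks collisions : (x a : Space n) → ℕ
    file₁ (x , _ , _) (a , _ , _) = 𝟙 (x Fin.≟ a)
    file₂ (_ , y , _) (_ , b , _) = 𝟙 (y Fin.≟ b)
    file₃ (_ , _ , z) (_ , _ , c) = 𝟙 (z Fin.≟ c)
    rooks x a      = file₁ x a + (file₂ x a + file₃ x a)
    collisions x a = file₂ x a * file₃ x a + (file₁ x a * file₂ x a + file₁ x a * file₃ x a)

    attackers : Space n → ℕ
    attackers x = ∑³ (λ a → 𝟙 (queenAttacks? a x))

    queen≤ : ∀ x a → 𝟙 (queenAttacks? a x) ≤ rooks x a + bishops x a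
    queen≤ (x , y , z) (a , b , c) = ≤-trans (𝟙-⊎ r? b?) (+-mono-≤
      (≤-trans (𝟙-⊎ (x Fin.≟ a) (y Fin.≟ b ⊎-dec z Fin.≟ c)) (+-monoʳ-≤ (𝟙 (x Fin.≟ a)) (𝟙-⊎ (y Fin.≟ b) (z Fin.≟ c))))
      (≤-trans (𝟙-⊎ b₁ (b₂ ⊎-dec b₃ ⊎-dec b₄)) (+-monoʳ-≤ (𝟙 b₁)
        (≤-trans (𝟙-⊎ b₂ (b₃ ⊎-dec b₄)) (+-monoʳ-≤ (𝟙 b₂) (𝟙-⊎ b₃ b₄))))))
      where
      p = diff x a
      q = diff y b
      r = diff z c
      b₁ = (p ℤ.+ q ℤ.+ r) ℤ.≟ 0ℤ
      b₂ = (p ℤ.+ q ℤ.- r) ℤ.≟ 0ℤ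
      b₃ = (p ℤ.- q ℤ.+ r) ℤ.≟ 0ℤ
      b₄ = (p ℤ.- q ℤ.- r) ℤ.≟ 0ℤ
      r? = x Fin.≟ a ⊎-dec y Fin.≟ b ⊎-dec z Fin.≟ c
      b? = b₁ ⊎-dec b₂ ⊎-dec b₃ ⊎-dec b₄

    -- Two bishop equations at once force one coordinate difference to vanish,
    -- so off the rook planes the bishop planes are disjoint.
    queen≥ : ∀ x a → rooks x a + bishops x a ≤
                     𝟙 (queenAttacks? a x) + (collisions x a + rooks x a * bishops x a)
    queen≥ s@(x , y , z) t@(a , b , c) = begin
      rooks s t + bishops s t
        ≤⟨ +-monoˡ-≤ (bishops s t) rooks≤ ⟩
      𝟙 r? + collisions s t + bishops s t
        ≡⟨ swap (𝟙 r?) (collisions s t) (bishops s t) ⟩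
      (𝟙 r? + bishops s t) + collisions s t
        ≤⟨ +-monoˡ-≤ (collisions s t) (union≥ r?) ⟩
      (𝟙 (r? ⊎-dec b?) + 𝟙 r? * bishops s t) + collisions s t
        ≤⟨ +-monoˡ-≤ (collisions s t) (+-monoʳ-≤ (𝟙 (r? ⊎-dec b?)) (*-monoˡ-≤ (bishops s t) 𝟙r≤)) ⟩
      (𝟙 (r? ⊎-dec b?) + rooks s t * bishops s t) + collisions s t
        ≡⟨ swap′ (𝟙 (r? ⊎-dec b?)) (rooks s t * bishops s t) (collisions s t) ⟩
      𝟙 (r? ⊎-dec b?) + (collisions s t + rooks s t * bishops s t) ∎
      where
      open ≤-Reasoning
      swap : ∀ k l m → k + l + m ≡ (k + m) + l
      swap = solve-∀
      swap′ : ∀ k l m → (k + l) + m ≡ k + (m + l)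
      swap′ = solve-∀
      p = diff x a
      q = diff y b
      r = diff z c
      b₁ = (p ℤ.+ q ℤ.+ r) ℤ.≟ 0ℤ
      b₂ = (p ℤ.+ q ℤ.- r) ℤ.≟ 0ℤ
      b₃ = (p ℤ.- q ℤ.+ r) ℤ.≟ 0ℤ
      b₄ = (p ℤ.- q ℤ.- r) ℤ.≟ 0ℤ
      r₁ = x Fin.≟ a
      r₂ = y Fin.≟ b
      r₃ = z Fin.≟ c
      r? = r₁ ⊎-dec r₂ ⊎-dec r₃
      b? = b₁ ⊎-dec b₂ ⊎-dec b₃ ⊎-dec b₄
      𝟙r≤ : 𝟙 r? ≤ rooks s t
      𝟙r≤ = ≤-trans (𝟙-⊎ r₁ (r₂ ⊎-dec r₃)) (+-monoʳ-≤ (𝟙 r₁) (𝟙-⊎ r₂ r₃))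
      rooks≤ : rooks s t ≤ 𝟙 r? + collisions s t
      rooks≤ = begin
        𝟙 r₁ + (𝟙 r₂ + 𝟙 r₃)                             ≡⟨ cong (_+_ (𝟙 r₁)) (𝟙-∩ r₂ r₃) ⟩
        𝟙 r₁ + (𝟙 (r₂ ⊎-dec r₃) + 𝟙 r₂ * 𝟙 r₃)           ≡⟨ +-assoc (𝟙 r₁) _ _ ⟨
        (𝟙 r₁ + 𝟙 (r₂ ⊎-dec r₃)) + 𝟙 r₂ * 𝟙 r₃           ≡⟨ cong (_+ 𝟙 r₂ * 𝟙 r₃) (𝟙-∩ r₁ (r₂ ⊎-dec r₃)) ⟩
        𝟙 r? + 𝟙 r₁ * 𝟙 (r₂ ⊎-dec r₃) + 𝟙 r₂ * 𝟙 r₃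
          ≤⟨ +-monoˡ-≤ (𝟙 r₂ * 𝟙 r₃) (+-monoʳ-≤ (𝟙 r?) (*-monoʳ-≤ (𝟙 r₁) (𝟙-⊎ r₂ r₃))) ⟩
        𝟙 r? + 𝟙 r₁ * (𝟙 r₂ + 𝟙 r₃) + 𝟙 r₂ * 𝟙 r₃        ≡⟨ regroup (𝟙 r?) (𝟙 r₁) (𝟙 r₂) (𝟙 r₃) ⟩
        𝟙 r? + collisions s t                            ∎
        where
        regroup : ∀ u k l m → u + k * (l + m) + l * m ≡ u + (l * m + (k * l + k * m))
        regroup = solve-∀
      module _ (¬r : ¬ (x ≡ a ⊎ y ≡ b ⊎ z ≡ c)) where
        sums : ∀ {u v w} → u ℤ.+ v ≡ + 2 ℤ.* w → u ≡ 0ℤ → v ≡ 0ℤ → + 2 ℤ.* w ≡ 0ℤ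
        sums eq u≡0 v≡0 = trans (sym eq) (cong₂ ℤ._+_ u≡0 v≡0)
        diffs : ∀ {u v w} → u ℤ.- v ≡ + 2 ℤ.* w → u ≡ 0ℤ → v ≡ 0ℤ → + 2 ℤ.* w ≡ 0ℤ
        diffs eq u≡0 v≡0 = trans (sym eq) (cong₂ ℤ._-_ u≡0 v≡0)
        p≢0 : + 2 ℤ.* p ≡ 0ℤ → ⊥
        p≢0 e = ¬r (inj₁ (2*diff≡0⇒≡ e))
        q≢0 : + 2 ℤ.* q ≡ 0ℤ → ⊥
        q≢0 e = ¬r (inj₂ (inj₁ (2*diff≡0⇒≡ e)))
        r≢0 : + 2 ℤ.* r ≡ 0ℤ → ⊥
        r≢0 e = ¬r (inj₂ (inj₂ (2*diff≡0⇒≡ e)))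
        e₁₂ : ∀ p q r → (p ℤ.+ q ℤ.+ r) ℤ.- (p ℤ.+ q ℤ.- r) ≡ + 2 ℤ.* r
        e₁₂ = ℤ-Solver.solve-∀
        e₁₃ : ∀ p q r → (p ℤ.+ q ℤ.+ r) ℤ.- (p ℤ.- q ℤ.+ r) ≡ + 2 ℤ.* q
        e₁₃ = ℤ-Solver.solve-∀
        e₁₄ : ∀ p q r → (p ℤ.+ q ℤ.+ r) ℤ.+ (p ℤ.- q ℤ.- r) ≡ + 2 ℤ.* p
        e₁₄ = ℤ-Solver.solve-∀
        e₂₃ : ∀ p q r → (p ℤ.+ q ℤ.- r) ℤ.+ (p ℤ.- q ℤ.+ r) ≡ + 2 ℤ.* p
        e₂₃ = ℤ-Solver.solve-∀
        e₂₄ : ∀ p q r → (p ℤ.+ q ℤ.- r) ℤ.- (p ℤ.- q ℤ.- r) ≡ + 2 ℤ.* q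
        e₂₄ = ℤ-Solver.solve-∀
        e₃₄ : ∀ p q r → (p ℤ.- q ℤ.+ r) ℤ.- (p ℤ.- q ℤ.- r) ≡ + 2 ℤ.* r
        e₃₄ = ℤ-Solver.solve-∀
        bishops≤ : bishops s t ≤ 𝟙 b?
        bishops≤ = ≤-trans (+-monoʳ-≤ (𝟙 b₁) (≤-trans (+-monoʳ-≤ (𝟙 b₂)
          (𝟙-disjoint b₃ b₄ (λ u v → r≢0 (diffs (e₃₄ p q r) u v))))
          (𝟙-disjoint b₂ (b₃ ⊎-dec b₄) λ where
            u (inj₁ v) → p≢0 (sums (e₂₃ p q r) u v)
            u (inj₂ v) → q≢0 (diffs (e₂₄ p q r) u v))))
          (𝟙-disjoint b₁ (b₂ ⊎-dec b₃ ⊎-dec b₄) λ where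
            u (inj₁ v)        → r≢0 (diffs (e₁₂ p q r) u v)
            u (inj₂ (inj₁ v)) → q≢0 (diffs (e₁₃ p q r) u v)
            u (inj₂ (inj₂ v)) → p≢0 (sums (e₁₄ p q r) u v))
      union≥ : (r? : Dec (x ≡ a ⊎ y ≡ b ⊎ z ≡ c)) →
               𝟙 r? + bishops s t ≤ 𝟙 (r? ⊎-dec b?) + 𝟙 r? * bishops s t
      -- On a rook plane the bishop planes may overlap, so all bishop incidences there are charged
      -- to the overlap term.
      union≥ (yes _) = s≤s (≤-reflexive (sym (+-identityʳ (bishops s t))))
      union≥ (no ¬r) = ≤-trans (bishops≤ ¬r) (≤-reflexive (sym (+-identityʳ (𝟙 b?))))

    private
      ones : Fin n → ℕ
      ones _ = 1

      at : Fin n → Fin n → ℕ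
      at x a = 𝟙 (x Fin.≟ a)

      ones≡n : sum ones ≡ n
      ones≡n = trans (sum-const n 1) (*-identityʳ n)

    file₁-total : ∀ x → ∑³ (file₁ x) ≡ n * n
    file₁-total (x , y , z) = trans (∑³-cong (λ (a , b , c) → sym (*-identityʳ (at x a))))
      (trans (∑³-product (at x) ones ones)
             (trans (cong₂ _*_ (sum-≟ x) (cong₂ _*_ ones≡n ones≡n)) (+-identityʳ (n * n))))

    file₂-total : ∀ x → ∑³ (file₂ x) ≡ n * n
    file₂-total (x , y , z) = trans
      (∑³-cong (λ (a , b , c) → sym (trans (+-identityʳ _) (*-identityʳ (at y b)))))
      (trans (∑³-product ones (at y) ones)
             (cong₂ _*_ ones≡n (trans (cong₂ _*_ (sum-≟ y) ones≡n) (+-identityʳ n))))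

    file₃-total : ∀ x → ∑³ (file₃ x) ≡ n * n
    file₃-total (x , y , z) = trans
      (∑³-cong (λ (a , b , c) → sym (trans (+-identityʳ _) (+-identityʳ (at z c)))))
      (trans (∑³-product ones ones (at z))
             (cong₂ _*_ ones≡n (trans (cong₂ _*_ ones≡n (sum-≟ z)) (*-identityʳ n))))

    rooks-total : ∀ x → ∑³ (rooks x) ≡ 3 * (n * n)
    rooks-total x = trans (∑³-+ (file₁ x) (λ a → file₂ x a + file₃ x a))
      (trans (cong₂ _+_ (file₁-total x)
               (trans (∑³-+ (file₂ x) (file₃ x)) (cong₂ _+_ (file₂-total x) (file₃-total x))))
             (cong (λ k → n * n + (n * n + k)) (sym (+-identityʳ (n * n)))))

    collisions-total : ∀ x → ∑³ (collisions x) ≡ 3 * n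
    collisions-total s@(x , y , z) = trans
      (∑³-+ (λ a → file₂ s a * file₃ s a) (λ a → file₁ s a * file₂ s a + file₁ s a * file₃ s a))
      (trans (cong₂ _+_ pair₂₃ (trans (∑³-+ (λ a → file₁ s a * file₂ s a) (λ a → file₁ s a * file₃ s a))
                                      (cong₂ _+_ pair₁₂ pair₁₃)))
             (cong (λ k → n + (n + k)) (sym (+-identityʳ n))))
      where
      pair₂₃ : ∑³ (λ a → file₂ s a * file₃ s a) ≡ n
      pair₂₃ = trans (∑³-cong (λ (a , b , c) → sym (+-identityʳ (at y b * at z c))))
        (trans (∑³-product ones (at y) (at z))
               (trans (cong₂ _*_ ones≡n (cong₂ _*_ (sum-≟ y) (sum-≟ z))) (*-identityʳ n)))
      pair₁₂ : ∑³ (λ a → file₁ s a * file₂ s a) ≡ n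
      pair₁₂ = trans (∑³-cong (λ (a , b , c) → cong (_*_ (at x a)) (sym (*-identityʳ (at y b)))))
        (trans (∑³-product (at x) (at y) ones)
               (trans (cong₂ _*_ (sum-≟ x) (cong₂ _*_ (sum-≟ y) ones≡n))
                      (trans (+-identityʳ (n + 0)) (+-identityʳ n))))
      pair₁₃ : ∑³ (λ a → file₁ s a * file₃ s a) ≡ n
      pair₁₃ = trans (∑³-cong (λ (a , b , c) → cong (_*_ (at x a)) (sym (+-identityʳ (at z c)))))
        (trans (∑³-product (at x) ones (at z))
               (trans (cong₂ _*_ (sum-≟ x) (cong₂ _*_ ones≡n (sum-≟ z)))
                      (trans (+-identityʳ (n * 1)) (*-identityʳ n))))

    private
      four : {f₁ f₂ f₃ f₄ : Fin n → ℕ} → sum f₁ ≤ 1 → sum f₂ ≤ 1 → sum f₃ ≤ 1 → sum f₄ ≤ 1 →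
             sum (λ i → f₁ i + (f₂ i + (f₃ i + f₄ i))) ≤ 4
      four {f₁} {f₂} {f₃} {f₄} s₁ s₂ s₃ s₄ = begin
        sum (λ i → f₁ i + (f₂ i + (f₃ i + f₄ i)))
          ≡⟨ trans (∑-distrib-+ f₁ _) (cong (_+_ (sum f₁)) (trans (∑-distrib-+ f₂ _)
               (cong (_+_ (sum f₂)) (∑-distrib-+ f₃ f₄)))) ⟩
        sum f₁ + (sum f₂ + (sum f₃ + sum f₄))
          ≤⟨ +-mono-≤ s₁ (+-mono-≤ s₂ (+-mono-≤ s₃ s₄)) ⟩
        4 ∎
        where open ≤-Reasoning

    -- Each coordinate enters a bishop equation with coefficient ±1, so a line parallel to an axis
    -- meets each of the four planes at most once.
    bishops-column₃ : ∀ x a b → sum (λ c → bishops x (a , b , c)) ≤ 4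
    bishops-column₃ (x , y , z) a b = four
      (sum-unique (λ c → (p ℤ.+ q ℤ.+ diff z c) ℤ.≟ 0ℤ) (plus (p ℤ.+ q)))
      (sum-unique (λ c → (p ℤ.+ q ℤ.- diff z c) ℤ.≟ 0ℤ) (minus (p ℤ.+ q)))
      (sum-unique (λ c → (p ℤ.- q ℤ.+ diff z c) ℤ.≟ 0ℤ) (plus (p ℤ.- q)))
      (sum-unique (λ c → (p ℤ.- q ℤ.- diff z c) ℤ.≟ 0ℤ) (minus (p ℤ.- q)))
      where
      p = diff x a
      q = diff y b
      plus : ∀ e (i j : Fin n) → e ℤ.+ diff z i ≡ 0ℤ → e ℤ.+ diff z j ≡ 0ℤ → i ≡ j
      plus e i j u v = diff-injective z (ℤ-Group.∙-cancelˡ e _ _ (trans u (sym v)))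
      minus : ∀ e (i j : Fin n) → e ℤ.- diff z i ≡ 0ℤ → e ℤ.- diff z j ≡ 0ℤ → i ≡ j
      minus e i j u v = diff-injective z (ℤ.neg-injective (ℤ-Group.∙-cancelˡ e _ _ (trans u (sym v))))

    bishops-column₂ : ∀ x a c → sum (λ b → bishops x (a , b , c)) ≤ 4
    bishops-column₂ (x , y , z) a c = four
      (sum-unique (λ b → (p ℤ.+ diff y b ℤ.+ r) ℤ.≟ 0ℤ) (plus r))
      (sum-unique (λ b → (p ℤ.+ diff y b ℤ.- r) ℤ.≟ 0ℤ) (plus (ℤ.- r)))
      (sum-unique (λ b → (p ℤ.- diff y b ℤ.+ r) ℤ.≟ 0ℤ) (minus r))
      (sum-unique (λ b → (p ℤ.- diff y b ℤ.- r) ℤ.≟ 0ℤ) (minus (ℤ.- r)))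
      where
      p = diff x a
      r = diff z c
      plus : ∀ e (i j : Fin n) → p ℤ.+ diff y i ℤ.+ e ≡ 0ℤ → p ℤ.+ diff y j ℤ.+ e ≡ 0ℤ → i ≡ j
      plus e i j u v = diff-injective y (ℤ-Group.∙-cancelˡ p _ _ (ℤ-Group.∙-cancelʳ e _ _ (trans u (sym v))))
      minus : ∀ e (i j : Fin n) → p ℤ.- diff y i ℤ.+ e ≡ 0ℤ → p ℤ.- diff y j ℤ.+ e ≡ 0ℤ → i ≡ j
      minus e i j u v = diff-injective y (ℤ.neg-injective
        (ℤ-Group.∙-cancelˡ p _ _ (ℤ-Group.∙-cancelʳ e _ _ (trans u (sym v)))))

    private
      weighted : (f g : Fin n → ℕ) → sum g ≤ 4 → ∀ w → (∀ i → f i ≡ w * g i) → sum f ≤ w * 4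
      weighted f g g≤4 w f≡ = ≤-trans
        (≤-reflexive (trans (sum-cong-≗ f≡) (sym (*-distribˡ-sum w g)))) (*-monoʳ-≤ w g≤4)

      plane₁ : ∀ x → sum (λ a → sum {n} (λ b → at x a * 4)) ≡ 4 * n
      plane₁ x = trans (sum-product {n} {n} (at x) (λ _ → 4))
        (trans (cong₂ _*_ (sum-≟ x) (sum-const n 4)) (trans (+-identityʳ (n * 4)) (*-comm n 4)))

      plane₂ : ∀ x → sum {n} (λ a → sum (λ b → at x b * 4)) ≡ 4 * n
      plane₂ x = trans (∑-comm {n} {n} (λ a b → at x b * 4)) (plane₁ x)

    -- Each rook plane is a union of n lines parallel to an axis, and each line carries at most four
    -- bishop incidences: 4n for every one of the three planes.
    overlap-total : ∀ x → ∑³ (λ a → rooks x a * bishops x a) ≤ 12 * n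
    overlap-total s@(x , y , z) = begin
      ∑³ (λ a → rooks s a * bishops s a)
        ≡⟨ ∑³-cong (λ a → trans (*-distribʳ-+ (bishops s a) (file₁ s a) _)
             (cong (_+_ (file₁ s a * bishops s a)) (*-distribʳ-+ (bishops s a) (file₂ s a) _))) ⟩
      ∑³ (λ a → f₁ a + (f₂ a + f₃ a))
        ≡⟨ trans (∑³-+ f₁ _) (cong (_+_ (∑³ f₁)) (∑³-+ f₂ f₃)) ⟩
      ∑³ f₁ + (∑³ f₂ + ∑³ f₃)
        ≤⟨ +-mono-≤
             (sum-mono (λ a → sum-mono (λ b → weighted _ _ (bishops-column₃ s a b) (at x a) (λ _ → refl))))
             (+-mono-≤
               (sum-mono (λ a → sum-mono (λ b → weighted _ _ (bishops-column₃ s a b) (at y b) (λ _ → refl))))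
               (≤-trans
                 -- Lines in the third direction lie inside the planes a = x and b = y but cross c =
                 -- z. That plane is cut along the second direction, so two sums are exchanged.
                 (≤-reflexive (sum-cong-≗ (λ a → ∑-comm (λ b c → f₃ (a , b , c)))))
                 (sum-mono (λ a → sum-mono (λ c →
                   weighted _ _ (bishops-column₂ s a c) (at z c) (λ _ → refl)))))) ⟩
      sum (λ a → sum {n} (λ b → at x a * 4)) +
        (sum {n} (λ a → sum (λ b → at y b * 4)) + sum {n} (λ a → sum (λ c → at z c * 4)))
        ≡⟨ cong₂ _+_ (plane₁ x) (cong₂ _+_ (plane₂ y) (plane₂ z)) ⟩
      4 * n + (4 * n + 4 * n)  ≡⟨ twelve n ⟩
      12 * n ∎
      where
      open ≤-Reasoning
      f₁ f₂ f₃ : Space n → ℕ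
      f₁ a = file₁ s a * bishops s a
      f₂ a = file₂ s a * bishops s a
      f₃ a = file₃ s a * bishops s a
      twelve : ∀ n → 4 * n + (4 * n + 4 * n) ≡ 12 * n
      twelve = solve-∀

    attackers-≤ : ∀ x → attackers x ≤ 6 * (n * n) + 1
    attackers-≤ x = begin
      attackers x                              ≤⟨ ∑³-mono (queen≤ x) ⟩
      ∑³ (λ a → rooks x a + bishops x a)       ≡⟨ ∑³-+ (rooks x) (bishops x) ⟩
      ∑³ (rooks x) + bishopTotal x             ≤⟨ +-mono-≤ (≤-reflexive (rooks-total x)) (bishopTotal-≤ x) ⟩
      3 * (n * n) + (3 * (n * n) + 1)          ≡⟨ eq (n * n) ⟩
      6 * (n * n) + 1                          ∎
      where
      open ≤-Reasoning
      eq : ∀ k → 3 * k + (3 * k + 1) ≡ 6 * k + 1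
      eq = solve-∀

    -- Rook planes give 3n², bishop planes at least 3n²/2, and double counting takes back at most 3n
    -- + 12n. Everything is doubled to clear the half, hence 9 and 30.
    attackers-≥ : ∀ x → 9 * (n * n) ≤ 2 * attackers x + 30 * n
    attackers-≥ x = *-cancelˡ-≤ 2 (begin
      2 * (9 * (n * n))                           ≡⟨ eq₁ (n * n) ⟩
      4 * (3 * (n * n)) + 6 * (n * n)
        ≤⟨ +-mono-≤ (≤-reflexive (cong (_*_ 4) (sym (rooks-total x)))) (bishopTotal-≥ x) ⟩
      4 * ∑³ (rooks x) + 4 * bishopTotal x        ≡⟨ *-distribˡ-+ 4 (∑³ (rooks x)) (bishopTotal x) ⟨
      4 * (∑³ (rooks x) + bishopTotal x)          ≡⟨ cong (_*_ 4) (∑³-+ (rooks x) (bishops x)) ⟨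
      4 * ∑³ (λ a → rooks x a + bishops x a)      ≤⟨ *-monoʳ-≤ 4 (∑³-mono (queen≥ x)) ⟩
      4 * ∑³ (λ a → 𝟙 (queenAttacks? a x) + (collisions x a + rooks x a * bishops x a))
        ≡⟨ cong (_*_ 4) (trans (∑³-+ (λ a → 𝟙 (queenAttacks? a x)) _)
             (cong (_+_ (attackers x)) (∑³-+ (collisions x) (λ a → rooks x a * bishops x a)))) ⟩
      4 * (attackers x + (∑³ (collisions x) + ∑³ (λ a → rooks x a * bishops x a)))
        ≤⟨ *-monoʳ-≤ 4 (+-monoʳ-≤ (attackers x)
             (+-mono-≤ (≤-reflexive (collisions-total x)) (overlap-total x))) ⟩
      4 * (attackers x + (3 * n + 12 * n))        ≡⟨ eq₂ (attackers x) n ⟩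
      2 * (2 * attackers x + 30 * n)              ∎)
      where
      open ≤-Reasoning
      eq₁ : ∀ k → 2 * (9 * k) ≡ 4 * (3 * k) + 6 * k
      eq₁ = solve-∀
      eq₂ : ∀ a n → 4 * (a + (3 * n + 12 * n)) ≡ 2 * (2 * a + 30 * n)
      eq₂ = solve-∀

-- Counting boards by binomial coefficients

module Configurations where
  open import Data.Fin.Base using (Fin; zero; suc)
  open import Data.List.Base using (List; []; _∷_; _++_; map; filter; length; tabulate; allFin; cartesianProduct)
  open import Data.List.Properties using (map-++; map-cong; map-∘; length-++; length-map)
  open import Data.List.Relation.Unary.All as All using (All)
  open import Data.Nat.Base
  open import Data.Nat.Combinatorics using (_C_; nC1≡n; nCk+nC[k+1]≡[n+1]C[k+1])
  open import Data.Nat.ListAction using () renaming (sum to sumˡ)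
  open import Data.Nat.ListAction.Properties using (sum-++)
  open import Data.Nat.Properties
  open import Data.Nat.Tactic.RingSolver using (solve-∀)
  open import Data.Product.Base using (_,_; proj₂)
  open import Data.Sum.Base using (inj₁)
  open import Function.Base using (_∘_; id)
  open import Relation.Binary.PropositionalEquality
  open import Relation.Nullary
  open Summation
  open Attacks

  ∑ : {A : Set} → List A → (A → ℕ) → ℕ
  ∑ xs f = sumˡ (map f xs)

  module _ {A : Set} where

    ∑-cong : ∀ xs {f g : A → ℕ} → (∀ x → f x ≡ g x) → ∑ xs f ≡ ∑ xs g
    ∑-cong xs f≗g = cong sumˡ (map-cong f≗g xs)

    ∑-++ : ∀ xs ys (f : A → ℕ) → ∑ (xs ++ ys) f ≡ ∑ xs f + ∑ ys f
    ∑-++ xs ys f = trans (cong sumˡ (map-++ f xs ys)) (sum-++ (map f xs) (map f ys))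

    ∑-map : ∀ {B : Set} (g : B → A) xs (f : A → ℕ) → ∑ (map g xs) f ≡ ∑ xs (f ∘ g)
    ∑-map g xs f = cong sumˡ (sym (map-∘ xs))

    ∑-zero : (xs : List A) → ∑ xs (λ _ → 0) ≡ 0
    ∑-zero []       = refl
    ∑-zero (_ ∷ xs) = ∑-zero xs

    ∑-+ : ∀ xs (f g : A → ℕ) → ∑ xs (λ x → f x + g x) ≡ ∑ xs f + ∑ xs g
    ∑-+ []       f g = refl
    ∑-+ (x ∷ xs) f g = trans (cong (_+_ (f x + g x)) (∑-+ xs f g))
                             (interchange (f x) (g x) (∑ xs f) (∑ xs g))
      where
      interchange : ∀ k l m n → k + l + (m + n) ≡ k + m + (l + n)
      interchange = solve-∀

    length≡∑ : (xs : List A) → length xs ≡ ∑ xs (λ _ → 1)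
    length≡∑ []       = refl
    length≡∑ (_ ∷ xs) = cong suc (length≡∑ xs)

    length-filter≡∑ : {P : A → Set} (P? : ∀ x → Dec (P x)) → ∀ xs → length (filter P? xs) ≡ ∑ xs (𝟙 ∘ P?)
    length-filter≡∑ P? []       = refl
    length-filter≡∑ P? (x ∷ xs) with P? x
    ... | yes _ = cong suc (length-filter≡∑ P? xs)
    ... | no _  = length-filter≡∑ P? xs

  ∑-swap : ∀ {A B : Set} xs ys (f : A → B → ℕ) →
           ∑ xs (λ x → ∑ ys (f x)) ≡ ∑ ys (λ y → ∑ xs (λ x → f x y))
  ∑-swap []       ys f = sym (∑-zero ys)
  ∑-swap (x ∷ xs) ys f = trans (cong (_+_ (∑ ys (f x))) (∑-swap xs ys f))
                               (sym (∑-+ ys (f x) (λ y → ∑ xs (λ x → f x y))))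

  ∑-tabulate : ∀ {A : Set} {n} (g : Fin n → A) f → ∑ (tabulate g) f ≡ sum (f ∘ g)
  ∑-tabulate {n = zero}  g f = refl
  ∑-tabulate {n = suc n} g f = cong (_+_ (f (g zero))) (∑-tabulate (g ∘ suc) f)

  ∑-cartesianProduct : ∀ {A B : Set} (xs : List A) (ys : List B) f →
                       ∑ (cartesianProduct xs ys) f ≡ ∑ xs (λ x → ∑ ys (λ y → f (x , y)))
  ∑-cartesianProduct []       ys f = refl
  ∑-cartesianProduct (x ∷ xs) ys f = trans (∑-++ (map (x ,_) ys) (cartesianProduct xs ys) f)
    (cong₂ _+_ (∑-map (x ,_) ys f) (∑-cartesianProduct xs ys f))

  ∑-allFin : ∀ n (f : Fin n → ℕ) → ∑ (allFin n) f ≡ sum f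
  ∑-allFin n = ∑-tabulate id

  ∑-spaces : ∀ n (f : Space n → ℕ) → ∑ (spaces n) f ≡ ∑³ f
  ∑-spaces n f = trans
    (trans (∑-cartesianProduct (allFin n) (cartesianProduct (allFin n) (allFin n)) f)
           (∑-allFin n (λ a → ∑ (cartesianProduct (allFin n) (allFin n)) (λ s → f (a , s)))))
    (sum-cong-≗ (λ a → trans
      (trans (∑-cartesianProduct (allFin n) (allFin n) (λ s → f (a , s)))
             (∑-allFin n (λ b → ∑ (allFin n) (λ c → f (a , b , c)))))
      (sum-cong-≗ (λ b → ∑-allFin n (λ c → f (a , b , c))))))

  length-spaces : ∀ n → length (spaces n) ≡ n ^ 3
  length-spaces n = trans (length≡∑ (spaces n)) (trans (∑-spaces n (λ _ → 1))
    (trans (sum-cong-≗ {n} (λ a → trans (sum-cong-≗ {n} (λ b → sum-const n 1)) (sum-const n (n * 1))))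
           (sum-const n (n * (n * 1)))))

  -- The sublists all of whose entries satisfy P are the sublists of the filtered list. A head
  -- satisfying P splits the count by Pascal's rule; a head failing P spoils every sublist
  -- containing it.
  ∑-choose : {A : Set} {P : A → Set} (P? : ∀ x → Dec (P x)) → ∀ k xs →
             ∑ (choose k xs) (𝟙 ∘ All.all? P?) ≡ length (filter P? xs) C k
  ∑-choose P? zero    xs       = refl
  ∑-choose P? (suc k) []       = refl
  ∑-choose P? (suc k) (x ∷ xs) = trans
    (trans (∑-++ (map (x ∷_) (choose k xs)) _ _)
           (cong₂ _+_ (∑-map (x ∷_) (choose k xs) _) (∑-choose P? (suc k) xs)))
    step
    where
    step : ∑ (choose k xs) (λ B → 𝟙 (All.all? P? (x ∷ B))) + length (filter P? xs) C suc k ≡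
           length (filter P? (x ∷ xs)) C suc k
    step with P? x
    ... | yes _ = trans (cong (_+ length (filter P? xs) C suc k) (∑-choose P? k xs))
                        (nCk+nC[k+1]≡[n+1]C[k+1] (length (filter P? xs)) k)
    ... | no _  = cong (_+ length (filter P? xs) C suc k) (∑-zero (choose k xs))

  length-choose : ∀ {A : Set} k (xs : List A) → length (choose k xs) ≡ length xs C k
  length-choose zero    xs       = refl
  length-choose (suc k) []       = refl
  length-choose (suc k) (x ∷ xs) = trans
    (trans (length-++ (map (x ∷_) (choose k xs)))
           (cong₂ _+_ (trans (length-map (x ∷_) (choose k xs)) (length-choose k xs))
                      (length-choose (suc k) xs)))
    (nCk+nC[k+1]≡[n+1]C[k+1] (length xs) k)

  private
    -- The identity (k + 1) C(m, k + 1) = (m - k) C(m, k) with the subtraction moved across, a form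
    -- in which Pascal's rule carries the induction.
    absorption : ∀ m k → suc k * (m C suc k) + k * (m C k) ≡ m * (m C k)
    absorption zero    zero    = refl
    absorption zero    (suc k) = cong₂ _+_ (*-zeroʳ (suc (suc k))) (*-zeroʳ (suc k))
    absorption (suc m) zero    = trans (+-identityʳ _) (trans (+-identityʳ _) (trans (nC1≡n (suc m)) (sym (*-identityʳ (suc m)))))
    absorption (suc m) (suc k) = begin
      suc (suc k) * (suc m C suc (suc k)) + suc k * (suc m C suc k)
        ≡⟨ cong₂ (λ u v → suc (suc k) * u + suc k * v)
             (sym (nCk+nC[k+1]≡[n+1]C[k+1] m (suc k))) (sym (nCk+nC[k+1]≡[n+1]C[k+1] m k)) ⟩
      suc (suc k) * (c₁ + c₂) + suc k * (c₀ + c₁)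
        ≡⟨ regroup k c₀ c₁ c₂ ⟩
      (suc (suc k) * c₂ + suc k * c₁) + (suc k * c₁ + k * c₀) + (c₀ + c₁)
        ≡⟨ cong₂ (λ u v → u + v + (c₀ + c₁)) (absorption m (suc k)) (absorption m k) ⟩
      m * c₁ + m * c₀ + (c₀ + c₁)  ≡⟨ collect m c₀ c₁ ⟩
      suc m * (c₀ + c₁)            ≡⟨ cong (_*_ (suc m)) (nCk+nC[k+1]≡[n+1]C[k+1] m k) ⟩
      suc m * (suc m C suc k)      ∎
      where
      open ≡-Reasoning
      c₀ = m C k
      c₁ = m C suc k
      c₂ = m C suc (suc k)
      regroup : ∀ k c₀ c₁ c₂ → suc (suc k) * (c₁ + c₂) + suc k * (c₀ + c₁) ≡
                (suc (suc k) * c₂ + suc k * c₁) + (suc k * c₁ + k * c₀) + (c₀ + c₁)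
      regroup = solve-∀
      collect : ∀ m c₀ c₁ → m * c₁ + m * c₀ + (c₀ + c₁) ≡ suc m * (c₀ + c₁)
      collect = solve-∀

  C-step : ∀ m k → suc k * (m C suc k) ≡ (m ∸ k) * (m C k)
  C-step m k = begin
    suc k * (m C suc k)                                ≡⟨ m+n∸n≡m (suc k * (m C suc k)) (k * (m C k)) ⟨
    suc k * (m C suc k) + k * (m C k) ∸ k * (m C k)    ≡⟨ cong (_∸ k * (m C k)) (absorption m k) ⟩
    m * (m C k) ∸ k * (m C k)                          ≡⟨ *-distribʳ-∸ (m C k) m k ⟨
    (m ∸ k) * (m C k)                                  ∎
    where open ≡-Reasoning

  module _ {n : ℕ} where

    unattacked : Space n → ℕ
    unattacked x = length (filter (λ a → ¬? (queenAttacks? a x)) (spaces n))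

    unattacked+attackers : ∀ x → unattacked x + attackers x ≡ n ^ 3
    unattacked+attackers x = begin
      unattacked x + attackers x
        ≡⟨ cong₂ _+_ (length-filter≡∑ (λ a → ¬? (queenAttacks? a x)) (spaces n))
                     (sym (∑-spaces n (λ a → 𝟙 (queenAttacks? a x)))) ⟩
      ∑ (spaces n) (λ a → 𝟙 (¬? (queenAttacks? a x))) + ∑ (spaces n) (λ a → 𝟙 (queenAttacks? a x))
        ≡⟨ ∑-+ (spaces n) _ _ ⟨
      ∑ (spaces n) (λ a → 𝟙 (¬? (queenAttacks? a x)) + 𝟙 (queenAttacks? a x))
        ≡⟨ ∑-cong (spaces n) (λ a → 𝟙-¬ (queenAttacks? a x)) ⟩
      ∑ (spaces n) (λ _ → 1)     ≡⟨ length≡∑ (spaces n) ⟨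
      length (spaces n)          ≡⟨ length-spaces n ⟩
      n ^ 3 ∎
      where open ≡-Reasoning

    -- A queen attacks its own space, since the first coordinates agree; hence an unattacked space
    -- is unoccupied.
    safe≡ : ∀ (B : List (Space n)) (x : Space n) → 𝟙 (safe? B x) ≡ 𝟙 (All.all? (λ a → ¬? (queenAttacks? a x)) B)
    safe≡ B x = 𝟙-cong (safe? B x) (All.all? (λ a → ¬? (queenAttacks? a x)) B) proj₂
      (λ none → (λ x∈B → All.lookup {P = λ a → ¬ QueenAttacks a x} none x∈B (inj₁ (inj₁ refl))) , none)

    -- Linearity of expectation: after exchanging the sums, a space x contributes the number of
    -- boards drawn entirely from the spaces that do not attack it.
    ∑-numSafe : ∑ (configurations n) numSafe ≡ ∑ (spaces n) (λ x → unattacked x C n)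
    ∑-numSafe = begin
      ∑ (configurations n) numSafe
        ≡⟨ ∑-cong (configurations n) (λ B → trans (length-filter≡∑ (safe? B) (spaces n))
             (∑-cong (spaces n) (safe≡ B))) ⟩
      ∑ (configurations n) (λ B → ∑ (spaces n) (λ x → 𝟙 (All.all? (λ a → ¬? (queenAttacks? a x)) B)))
        ≡⟨ ∑-swap (configurations n) (spaces n) _ ⟩
      ∑ (spaces n) (λ x → ∑ (configurations n) (λ B → 𝟙 (All.all? (λ a → ¬? (queenAttacks? a x)) B)))
        ≡⟨ ∑-cong (spaces n) (λ x → ∑-choose (λ a → ¬? (queenAttacks? a x)) n (spaces n)) ⟩
      ∑ (spaces n) (λ x → unattacked x C n) ∎
      where open ≡-Reasoning

-- Natural numbers inside the rationals, and the Archimedean property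

module Naturals where
  open import Data.Integer.Base as ℤ using (ℤ; +_; -[1+_])
  import Data.Integer.Properties as ℤ
  import Data.Integer.Tactic.RingSolver as ℤ-Solver
  open import Data.Nat.Base as ℕ using (ℕ; zero; suc)
  import Data.Nat.Properties as ℕ
  open import Data.Product.Base using (_,_; proj₁; proj₂; ∃-syntax)
  open import Data.Rational.Base
  open import Data.Rational.Properties
  import Data.Rational.Unnormalised.Base as ℚᵘ
  import Data.Rational.Unnormalised.Properties as ℚᵘ
  open import Relation.Binary.PropositionalEquality

  infixl 7 _⊗_

  _⊗_ : ∀ {p q} → 0ℚ ≤ p → 0ℚ ≤ q → 0ℚ ≤ p * q
  _⊗_ {p} {q} 0≤p 0≤q = nonNegative⁻¹ (p * q)
    {{nonNeg*nonNeg⇒nonNeg p {{nonNegative 0≤p}} q {{nonNegative 0≤q}}}}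

  *-monoˡ : ∀ {r p q} → 0ℚ ≤ r → p ≤ q → r * p ≤ r * q
  *-monoˡ {r} 0≤r = *-monoˡ-≤-nonNeg r {{nonNegative 0≤r}}

  *-monoʳ : ∀ {r p q} → 0ℚ ≤ r → p ≤ q → p * r ≤ q * r
  *-monoʳ {r} 0≤r = *-monoʳ-≤-nonNeg r {{nonNegative 0≤r}}

  ι : ℕ → ℚ
  ι n = + n / 1

  private
    ι≃ : ∀ n → toℚᵘ (ι n) ℚᵘ.≃ ℚᵘ.mkℚᵘ (+ n) 0
    ι≃ n = toℚᵘ-fromℚᵘ (ℚᵘ.mkℚᵘ (+ n) 0)

  ι-mono : ∀ {m n} → m ℕ.≤ n → ι m ≤ ι n
  ι-mono {m} {n} m≤n = toℚᵘ-cancel-≤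
    (ℚᵘ.≤-respˡ-≃ (ℚᵘ.≃-sym (ι≃ m)) (ℚᵘ.≤-respʳ-≃ (ℚᵘ.≃-sym (ι≃ n))
      (ℚᵘ.*≤* (ℤ.*-monoʳ-≤-nonNeg (+ 1) (ℤ.+≤+ m≤n)))))

  ι-+ : ∀ m n → ι (m ℕ.+ n) ≡ ι m + ι n
  ι-+ m n = toℚᵘ-injective (begin
    toℚᵘ (ι (m ℕ.+ n))                       ≈⟨ ι≃ (m ℕ.+ n) ⟩
    ℚᵘ.mkℚᵘ (+ (m ℕ.+ n)) 0                  ≈⟨ ℚᵘ.*≡* (cong (ℤ._* + 1) (sym (cong₂ ℤ._+_ (ℤ.*-identityʳ (+ m)) (ℤ.*-identityʳ (+ n))))) ⟩
    ℚᵘ.mkℚᵘ (+ m) 0 ℚᵘ.+ ℚᵘ.mkℚᵘ (+ n) 0     ≈⟨ ℚᵘ.+-cong (ι≃ m) (ι≃ n) ⟨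
    toℚᵘ (ι m) ℚᵘ.+ toℚᵘ (ι n)               ≈⟨ toℚᵘ-homo-+ (ι m) (ι n) ⟨
    toℚᵘ (ι m + ι n)                         ∎)
    where open ℚᵘ.≃-Reasoning

  ι-* : ∀ m n → ι (m ℕ.* n) ≡ ι m * ι n
  ι-* m n = toℚᵘ-injective (begin
    toℚᵘ (ι (m ℕ.* n))                       ≈⟨ ι≃ (m ℕ.* n) ⟩
    ℚᵘ.mkℚᵘ (+ (m ℕ.* n)) 0                  ≈⟨ ℚᵘ.*≡* (cong (ℤ._* + 1) (ℤ.pos-* m n)) ⟩
    ℚᵘ.mkℚᵘ (+ m) 0 ℚᵘ.* ℚᵘ.mkℚᵘ (+ n) 0     ≈⟨ ℚᵘ.*-cong (ι≃ m) (ι≃ n) ⟨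
    toℚᵘ (ι m) ℚᵘ.* toℚᵘ (ι n)               ≈⟨ toℚᵘ-homo-* (ι m) (ι n) ⟨
    toℚᵘ (ι m * ι n)                         ∎)
    where open ℚᵘ.≃-Reasoning

  0≤ι : ∀ n → 0ℚ ≤ ι n
  0≤ι n = ι-mono {0} {n} ℕ.z≤n

  ι-pos : ∀ n → Positive (ι (suc n))
  ι-pos n = normalize-pos (suc n) 1

  ι-cancel : ∀ d .{{_ : ℕ.NonZero d}} s → ι d * (+ s / d) ≡ ι s
  ι-cancel (suc d) s = toℚᵘ-injective (begin
    toℚᵘ (ι (suc d) * (+ s / suc d))             ≈⟨ toℚᵘ-homo-* (ι (suc d)) (+ s / suc d) ⟩
    toℚᵘ (ι (suc d)) ℚᵘ.* toℚᵘ (+ s / suc d)     ≈⟨ ℚᵘ.*-cong (ι≃ (suc d)) (toℚᵘ-fromℚᵘ (ℚᵘ.mkℚᵘ (+ s) d)) ⟩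
    ℚᵘ.mkℚᵘ (+ suc d) 0 ℚᵘ.* ℚᵘ.mkℚᵘ (+ s) d     ≈⟨ ℚᵘ.*≡* (eq (+ suc d) (+ s)) ⟩
    ℚᵘ.mkℚᵘ (+ s) 0                              ≈⟨ ι≃ s ⟨
    toℚᵘ (ι s)                                   ∎)
    where
    open ℚᵘ.≃-Reasoning
    eq : ∀ d s → d ℤ.* s ℤ.* + 1 ≡ s ℤ.* (+ 1 ℤ.* d)
    eq = ℤ-Solver.solve-∀

  infix 8 ⅟_

  ⅟_ : ℕ → ℚ
  ⅟ n = + 1 / suc n

  0≤⅟ : ∀ n → 0ℚ ≤ ⅟ n
  0≤⅟ n = nonNegative⁻¹ (⅟ n) {{normalize-nonNeg 1 (suc n)}}

  -- The denominator of ε is a witness: the product is the numerator, a positive integer.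
  archimedean : ∀ ε → 0ℚ < ε → ∃[ d ] 1ℚ ≤ ι d * ε
  archimedean ε@(mkℚ (+ suc s) d _) _ = suc d , (begin
    ι 1                          ≤⟨ ι-mono {1} {suc s} (ℕ.s≤s ℕ.z≤n) ⟩
    ι (suc s)                    ≡⟨ ι-cancel (suc d) (suc s) ⟨
    ι (suc d) * (+ suc s / suc d) ≡⟨ cong (_*_ (ι (suc d))) (fromℚᵘ-toℚᵘ ε) ⟩
    ι (suc d) * ε                ∎)
    where open ≤-Reasoning
  archimedean (mkℚ (+ zero) d _) (*<* (ℤ.+<+ ()))
  archimedean (mkℚ -[1+ _ ] d _) (*<* ())

  eventually-small : ∀ D ε → 0ℚ < ε → ∃[ N ] (∀ n → N ℕ.≤ n → ι D * ⅟ n ≤ ε)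
  eventually-small D ε 0<ε = D ℕ.* d , λ n D*d≤n →
    *-cancelˡ-≤-pos (ι (suc n)) {{ι-pos n}} (begin
      ι (suc n) * (ι D * ⅟ n)   ≡⟨ *-comm (ι (suc n)) _ ⟩
      ι D * ⅟ n * ι (suc n)     ≡⟨ trans (*-assoc (ι D) _ _) (cong (_*_ (ι D)) (trans (*-comm (⅟ n) _) (ι-cancel (suc n) 1))) ⟩
      ι D * 1ℚ                  ≤⟨ *-monoˡ (0≤ι D) 1≤dε ⟩
      ι D * (ι d * ε)           ≡⟨ *-assoc (ι D) (ι d) ε ⟨
      ι D * ι d * ε             ≡⟨ cong (_* ε) (ι-* D d) ⟨
      ι (D ℕ.* d) * ε           ≤⟨ *-monoʳ (<⇒≤ 0<ε) (ι-mono (ℕ.m≤n⇒m≤1+n D*d≤n)) ⟩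
      ι (suc n) * ε             ∎)
    where
    open ≤-Reasoning
    d = proj₁ (archimedean ε 0<ε)
    1≤dε = proj₂ (archimedean ε 0<ε)

-- Tangent and secant inequalities for the partial sums of the exponential series

module Exponential where
  open import Data.Nat.Base as ℕ using (ℕ; zero; suc)
  import Data.Nat.Properties as ℕ
  open import Data.Rational.Base
  open import Data.Rational.Properties
  open import Data.Rational.Solver using (module +-*-Solver)
  open import Relation.Binary.PropositionalEquality
  open Naturals

  expTerm-step : ∀ x k → ι (suc k) * expTerm x (suc k) ≡ x * expTerm x k
  expTerm-step x k = trans
    (solve 4 (λ i e x r → i :* (e :* (x :* r)) := (i :* r) :* (x :* e)) refl (ι (suc k)) (expTerm x k) x (⅟ k))
    (trans (cong (_* (x * expTerm x k)) (ι-cancel (suc k) 1)) (*-identityˡ _))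
    where open +-*-Solver

  private
    -- The k + 1 copies of b that `expTerm-step` supplies and one further copy cancel the new
    -- denominator k + 2. Both inductions on terms close in this way.
    average : ∀ k a b → (ι (suc k) * b + b) * (a * ⅟ (suc k)) ≡ a * b
    average k a b = trans
      (solve 4 (λ i a b r → (i :* b :+ b) :* (a :* r) := (i :+ con 1ℚ) :* r :* (a :* b)) refl (ι (suc k)) a b (⅟ (suc k)))
      (trans (cong (λ i → i * ⅟ (suc k) * (a * b)) (trans (+-comm (ι (suc k)) 1ℚ) (sym (ι-+ 1 (suc k)))))
      (trans (cong (_* (a * b)) (ι-cancel (suc (suc k)) 1)) (*-identityˡ (a * b))))
      where open +-*-Solver

    ≤-+ : ∀ {p q} → 0ℚ ≤ q → p ≤ p + q
    ≤-+ {p} 0≤q = ≤-trans (≤-reflexive (sym (+-identityʳ p))) (+-monoʳ-≤ p 0≤q)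

  0≤expTerm : ∀ {x} → 0ℚ ≤ x → ∀ k → 0ℚ ≤ expTerm x k
  0≤expTerm {x} 0≤x k = nonNegative⁻¹ _ {{ExpConvergence.t-nonNeg x (nonNegative 0≤x) k}}

  1≤expSum : ∀ {x} → 0ℚ ≤ x → ∀ k → 1ℚ ≤ expSum x k
  1≤expSum {x} 0≤x = ExpConvergence.1≤S x (nonNegative 0≤x)

  0≤expSum : ∀ {x} → 0ℚ ≤ x → ∀ k → 0ℚ ≤ expSum x k
  0≤expSum 0≤x k = ≤-trans (nonNegative⁻¹ 1ℚ) (1≤expSum 0≤x k)

  expSum-mono : ∀ {x} → 0ℚ ≤ x → ∀ {j k} → j ℕ.≤′ k → expSum x j ≤ expSum x k
  expSum-mono 0≤x ℕ.≤′-refl               = ≤-refl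
  expSum-mono {x} 0≤x {k = suc k} (ℕ.≤′-step j≤k) =
    ≤-trans (expSum-mono 0≤x j≤k) (ExpConvergence.S-step x (nonNegative 0≤x) k)

  expSum-0 : ∀ k → expSum 0ℚ k ≡ 1ℚ
  expSum-0 zero    = refl
  expSum-0 (suc k) = trans (cong₂ _+_ (expSum-0 k)
    (trans (cong (_*_ (expTerm 0ℚ k)) (*-zeroˡ (⅟ k))) (*-zeroʳ (expTerm 0ℚ k)))) (+-identityʳ 1ℚ)

  module _ {w t : ℚ} (0≤w : 0ℚ ≤ w) (0≤t : 0ℚ ≤ t) where
    open ≤-Reasoning
    open +-*-Solver

    private
      v = w + t

      0≤v : 0ℚ ≤ v
      0≤v = ≤-trans 0≤w (≤-+ 0≤t)

    -- Convexity of xᵏ⁺¹/(k+1)!, whose derivative is xᵏ/k!: the slope between w and v = w + t is at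
    -- most the derivative at v. `expTerm-secant` is the companion bound by the derivative at w.
    expTerm-tangent : ∀ k → expTerm v (suc k) ≤ expTerm w (suc k) + t * expTerm v k
    expTerm-tangent zero = ≤-reflexive
      (solve 2 (λ w t → con 1ℚ :* ((w :+ t) :* con 1ℚ) := con 1ℚ :* (w :* con 1ℚ) :+ t :* con 1ℚ) refl w t)
    expTerm-tangent (suc k) = begin
      E * (v * r)
        ≡⟨ solve 4 (λ e w t r → e :* ((w :+ t) :* r) := (w :* e :+ t :* e) :* r) refl E w t r ⟩
      (w * E + t * E) * r
        ≤⟨ *-monoʳ (0≤⅟ (suc k)) (+-monoˡ-≤ (t * E) (*-monoˡ 0≤w (expTerm-tangent k))) ⟩
      (w * (F + t * E′) + t * E) * r
        ≡⟨ solve 6 (λ f w t e e′ r → (w :* (f :+ t :* e′) :+ t :* e) :* r :=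
                                     f :* (w :* r) :+ (w :* e′ :+ e) :* (t :* r)) refl F w t E E′ r ⟩
      F * (w * r) + (w * E′ + E) * (t * r)
        -- Enlarging w to v is the only loss besides the induction hypothesis; it turns `w * E′`
        -- into `v * E′`, which is k + 1 copies of `E`.
        ≤⟨ +-monoʳ-≤ (F * (w * r)) (*-monoʳ (0≤t ⊗ 0≤⅟ (suc k))
             (+-monoˡ-≤ E (*-monoʳ (0≤expTerm 0≤v k) (≤-+ {w} 0≤t)))) ⟩
      F * (w * r) + (v * E′ + E) * (t * r)
        ≡⟨ cong (λ z → F * (w * r) + (z + E) * (t * r)) (expTerm-step v k) ⟨
      F * (w * r) + (ι (suc k) * E + E) * (t * r)
        ≡⟨ cong (_+_ (F * (w * r))) (average k t E) ⟩
      F * (w * r) + t * E ∎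
      where
      r  = ⅟ (suc k)
      E  = expTerm v (suc k)
      E′ = expTerm v k
      F  = expTerm w (suc k)

    expTerm-secant : ∀ k → expTerm w (suc k) + t * expTerm w k ≤ expTerm v (suc k)
    expTerm-secant zero = ≤-reflexive
      (solve 2 (λ w t → con 1ℚ :* (w :* con 1ℚ) :+ t :* con 1ℚ := con 1ℚ :* ((w :+ t) :* con 1ℚ)) refl w t)
    expTerm-secant (suc k) = begin
      F * (w * r) + t * F                          ≡⟨ cong (_+_ (F * (w * r))) (average k t F) ⟨
      F * (w * r) + (ι (suc k) * F + F) * (t * r)  ≡⟨ cong (λ z → F * (w * r) + (z + F) * (t * r)) (expTerm-step w k) ⟩
      F * (w * r) + (w * F′ + F) * (t * r)
        ≡⟨ solve 5 (λ f w t f′ r → f :* (w :* r) :+ (w :* f′ :+ f) :* (t :* r) :=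
                                   (w :* (f :+ t :* f′) :+ t :* f) :* r) refl F w t F′ r ⟩
      (w * (F + t * F′) + t * F) * r
        -- The second summand needs `F ≤ E`; this too follows from the induction hypothesis, on
        -- dropping the nonnegative `t * F′`.
        ≤⟨ *-monoʳ (0≤⅟ (suc k)) (+-mono-≤ (*-monoˡ 0≤w (expTerm-secant k))
             (*-monoˡ 0≤t (≤-trans (≤-+ (0≤t ⊗ 0≤expTerm 0≤w k)) (expTerm-secant k)))) ⟩
      (w * E + t * E) * r
        ≡⟨ solve 4 (λ e w t r → (w :* e :+ t :* e) :* r := e :* ((w :+ t) :* r)) refl E w t r ⟩
      E * (v * r) ∎
      where
      r  = ⅟ (suc k)
      E  = expTerm v (suc k)
      F  = expTerm w (suc k)
      F′ = expTerm w k

    private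
      tangent : ∀ k → expSum v (suc k) ≤ expSum w (suc k) + t * expSum v k
      tangent zero    = ≤-trans (+-monoʳ-≤ 1ℚ (expTerm-tangent zero))
        (≤-reflexive (sym (+-assoc 1ℚ (expTerm w 1) (t * 1ℚ))))
      tangent (suc k) = ≤-trans (+-mono-≤ (tangent k) (expTerm-tangent (suc k)))
        (≤-reflexive (solve 5 (λ s e t s′ e′ → (s :+ t :* s′) :+ (e :+ t :* e′) := (s :+ e) :+ t :* (s′ :+ e′))
          refl (expSum w (suc k)) (expTerm w (suc (suc k))) t (expSum v k) (expTerm v (suc k))))

      secant : ∀ k → expSum w (suc k) + t * expSum w k ≤ expSum v (suc k)
      secant zero    = ≤-trans (≤-reflexive (+-assoc 1ℚ (expTerm w 1) (t * 1ℚ)))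
        (+-monoʳ-≤ 1ℚ (expTerm-secant zero))
      secant (suc k) = ≤-trans
        (≤-reflexive (solve 5 (λ s e t s′ e′ → (s :+ e) :+ t :* (s′ :+ e′) := (s :+ t :* s′) :+ (e :+ t :* e′))
          refl (expSum w (suc k)) (expTerm w (suc (suc k))) t (expSum w k) (expTerm w (suc k))))
        (+-mono-≤ (secant k) (expTerm-secant (suc k)))

    -- A finite form of 1 - t ≤ e^(-t). Differentiating a partial sum lowers its index by one; here
    -- the derivative stands on the larger side, so its index can be raised back to k.
    expSum-tangent : ∀ k → expSum v k ≤ expSum w k + t * expSum v k
    expSum-tangent zero    = ≤-+ (0≤t ⊗ nonNegative⁻¹ 1ℚ)
    expSum-tangent (suc k) = ≤-trans (tangent k) (+-monoʳ-≤ (expSum w (suc k))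
      (*-monoˡ 0≤t (ExpConvergence.S-step v (nonNegative 0≤v) k)))

    -- A finite form of 1 + t ≤ e^t. Now the derivative stands on the smaller side, so the index on
    -- the right has to be one higher; already for k = 0 equal indices would claim 1 + t ≤ 1.
    expSum-secant : ∀ k → (1ℚ + t) * expSum w k ≤ expSum v (suc k)
    expSum-secant k = begin
      (1ℚ + t) * S      ≡⟨ solve 2 (λ t s → (con 1ℚ :+ t) :* s := s :+ t :* s) refl t S ⟩
      S + t * S         ≤⟨ +-monoˡ-≤ (t * S) (ExpConvergence.S-step w (nonNegative 0≤w) k) ⟩
      expSum w (suc k) + t * S  ≤⟨ secant k ⟩
      expSum v (suc k)  ∎
      where S = expSum w k

-- Binomial quotients against the exponential, and the two limits

module Asymptotics where
  open import Data.Integer.Base using (+_)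
  open import Data.List.Base using ([]; _∷_; length)
  open import Data.Nat.Base as ℕ using (ℕ; zero; suc; _∸_)
  open import Data.Nat.Combinatorics using (_C_; nCk+nC[k+1]≡[n+1]C[k+1])
  import Data.Nat.Properties as ℕ
  import Data.Nat.Tactic.RingSolver as ℕ-Solver
  open import Data.Product.Base using (_,_; proj₁; proj₂)
  open import Data.Rational.Base
  open import Data.Rational.Properties
  open import Data.Rational.Solver using (module +-*-Solver)
  open import Relation.Binary.PropositionalEquality
  open Naturals
  open Exponential
  open Attacks using (attackers; attackers-≤; attackers-≥)
  open Configurations
  open ≤-Reasoning
  open +-*-Solver

  private
    ≤+⇒-≤ : ∀ {p q r} → p ≤ q + r → p - r ≤ q
    ≤+⇒-≤ {p} {q} {r} p≤q+r = ≤-trans (+-monoˡ-≤ (- r) p≤q+r)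
      (≤-reflexive (solve 2 (λ q r → q :+ r :- r := q) refl q r))

    *-cancelˡ : ∀ {r p q} → 0ℚ < r → r * p ≤ r * q → p ≤ q
    *-cancelˡ {r} 0<r = *-cancelˡ-≤-pos r {{positive 0<r}}

    *-pos : ∀ {p q} → 0ℚ < p → 0ℚ < q → 0ℚ < p * q
    *-pos {p} {q} 0<p 0<q = positive⁻¹ (p * q) {{pos*pos⇒pos p {{positive 0<p}} q {{positive 0<q}}}}

    ι-suc : ∀ k t → ι (suc k) * t ≡ ι k * t + t
    ι-suc k t = trans (cong (_* t) (ι-+ 1 k)) (solve 2 (λ i t → (con 1ℚ :+ i) :* t := i :* t :+ t) refl (ι k) t)

    0<ι-suc : ∀ k → 0ℚ < ι (suc k)
    0<ι-suc k = positive⁻¹ (ι (suc k)) {{ι-pos k}}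

    0<ι : ∀ {k} → 1 ℕ.≤ k → 0ℚ < ι k
    0<ι {suc k} _ = 0<ι-suc k

  ι-C-step : ∀ m k → ι (suc k) * ι (m C suc k) ≡ ι (m ∸ k) * ι (m C k)
  ι-C-step m k = trans (sym (ι-* (suc k) (m C suc k))) (trans (cong ι (C-step m k)) (ι-* (m ∸ k) (m C k)))

  C-positive : ∀ {m k} → k ℕ.≤ m → 1 ℕ.≤ m C k
  C-positive {m}     {zero}  _           = ℕ.≤-refl
  C-positive {suc m} {suc k} (ℕ.s≤s k≤m) = ℕ.≤-trans (C-positive k≤m)
    (ℕ.≤-trans (ℕ.m≤m+n (m C k) (m C suc k)) (ℕ.≤-reflexive (nCk+nC[k+1]≡[n+1]C[k+1] m k)))

  -- Each further piece multiplies C(m, k) / C(N, k) by (m - k)/(N - k) ≤ m/N ≤ 1 - t, and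
  -- `expSum-tangent` absorbs the factor 1 - t into the argument. The index K is the same
  -- throughout.
  C-ratio-≤ : ∀ K m N {t} → 0ℚ ≤ t → m ℕ.≤ N → 0ℚ < ι N → ι m ≤ (1ℚ - t) * ι N →
              ∀ k → expSum (ι k * t) K * ι (m C k) ≤ ι (N C k)
  C-ratio-≤ K m N {t} 0≤t m≤N 0<N m≤[1-t]N zero = ≤-reflexive
    (trans (cong (λ x → expSum x K * 1ℚ) (*-zeroˡ t)) (trans (*-identityʳ _) (expSum-0 K)))
  C-ratio-≤ K m N {t} 0≤t m≤N 0<N m≤[1-t]N (suc k) = *-cancelˡ (0<ι-suc k) (begin
    ι (suc k) * (S′ * ι (m C suc k))
      ≡⟨ solve 3 (λ i s c → i :* (s :* c) := s :* (i :* c)) refl (ι (suc k)) S′ (ι (m C suc k)) ⟩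
    S′ * (ι (suc k) * ι (m C suc k))            ≡⟨ cong (_*_ S′) (ι-C-step m k) ⟩
    S′ * (ι (m ∸ k) * ι (m C k))
      ≤⟨ *-monoˡ (0≤expSum (0≤ι (suc k) ⊗ 0≤t) K) (*-monoʳ (0≤ι (m C k)) factor) ⟩
    S′ * ((1ℚ - t) * ι (N ∸ k) * ι (m C k))
      ≡⟨ solve 4 (λ s t d c → s :* ((con 1ℚ :- t) :* d :* c) := (s :- t :* s) :* (d :* c))
           refl S′ t (ι (N ∸ k)) (ι (m C k)) ⟩
    (S′ - t * S′) * (ι (N ∸ k) * ι (m C k))
      ≤⟨ *-monoʳ (0≤ι (N ∸ k) ⊗ 0≤ι (m C k)) (≤+⇒-≤ {S′} {S} {t * S′} tangent) ⟩
    S * (ι (N ∸ k) * ι (m C k))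
      ≡⟨ solve 3 (λ s d c → s :* (d :* c) := d :* (s :* c)) refl S (ι (N ∸ k)) (ι (m C k)) ⟩
    ι (N ∸ k) * (S * ι (m C k))
      ≤⟨ *-monoˡ (0≤ι (N ∸ k)) (C-ratio-≤ K m N 0≤t m≤N 0<N m≤[1-t]N k) ⟩
    ι (N ∸ k) * ι (N C k)                       ≡⟨ ι-C-step N k ⟨
    ι (suc k) * ι (N C suc k)                   ∎)
    where
    S  = expSum (ι k * t) K
    S′ = expSum (ι (suc k) * t) K
    tangent : S′ ≤ S + t * S′
    tangent = subst (λ x → expSum x K ≤ S + t * expSum x K) (sym (ι-suc k t))
      (expSum-tangent (0≤ι k ⊗ 0≤t) 0≤t K)
    cross : N ℕ.* (m ∸ k) ℕ.≤ m ℕ.* (N ∸ k)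
    cross = subst₂ ℕ._≤_
      (trans (cong (_∸ N ℕ.* k) (ℕ.*-comm m N)) (sym (ℕ.*-distribˡ-∸ N m k)))
      (sym (ℕ.*-distribˡ-∸ m N k))
      (ℕ.∸-monoʳ-≤ (m ℕ.* N) (ℕ.*-monoˡ-≤ k m≤N))
    factor : ι (m ∸ k) ≤ (1ℚ - t) * ι (N ∸ k)
    factor = *-cancelˡ 0<N (begin
      ι N * ι (m ∸ k)                   ≡⟨ ι-* N (m ∸ k) ⟨
      ι (N ℕ.* (m ∸ k))                 ≤⟨ ι-mono cross ⟩
      ι (m ℕ.* (N ∸ k))                 ≡⟨ ι-* m (N ∸ k) ⟩
      ι m * ι (N ∸ k)                   ≤⟨ *-monoʳ (0≤ι (N ∸ k)) m≤[1-t]N ⟩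
      (1ℚ - t) * ι N * ι (N ∸ k)
        ≡⟨ solve 3 (λ t n d → t :* n :* d := n :* (t :* d)) refl (1ℚ - t) (ι N) (ι (N ∸ k)) ⟩
      ι N * ((1ℚ - t) * ι (N ∸ k))      ∎)

  -- The reverse estimate: each piece multiplies C(N, k) / C(m, k) by at most 1 + w. Absorbing this
  -- by `expSum-secant` costs one term of the series per piece, so the index is k itself.
  C-ratio-≥ : ∀ m N n {w} → 0ℚ ≤ w → (∀ k → k ℕ.≤ n → ι (N ∸ k) ≤ (1ℚ + w) * ι (m ∸ k)) →
              ∀ k → k ℕ.≤ n → ι (N C k) ≤ expSum (ι k * w) k * ι (m C k)
  C-ratio-≥ m N n {w} 0≤w factor zero    _   = ≤-refl
  C-ratio-≥ m N n {w} 0≤w factor (suc k) k<n = *-cancelˡ (0<ι-suc k) (begin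
    ι (suc k) * ι (N C suc k)                   ≡⟨ ι-C-step N k ⟩
    ι (N ∸ k) * ι (N C k)
      ≤⟨ *-monoˡ (0≤ι (N ∸ k)) (C-ratio-≥ m N n 0≤w factor k (ℕ.<⇒≤ k<n)) ⟩
    ι (N ∸ k) * (S * ι (m C k))
      ≤⟨ *-monoʳ (0≤expSum (0≤ι k ⊗ 0≤w) k ⊗ 0≤ι (m C k)) (factor k (ℕ.<⇒≤ k<n)) ⟩
    (1ℚ + w) * ι (m ∸ k) * (S * ι (m C k))
      ≡⟨ solve 4 (λ w d s c → w :* d :* (s :* c) := (w :* s) :* (d :* c))
           refl (1ℚ + w) (ι (m ∸ k)) S (ι (m C k)) ⟩
    ((1ℚ + w) * S) * (ι (m ∸ k) * ι (m C k))
      ≤⟨ *-monoʳ (0≤ι (m ∸ k) ⊗ 0≤ι (m C k)) secant ⟩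
    S′ * (ι (m ∸ k) * ι (m C k))                ≡⟨ cong (_*_ S′) (ι-C-step m k) ⟨
    S′ * (ι (suc k) * ι (m C suc k))
      ≡⟨ solve 3 (λ i s c → s :* (i :* c) := i :* (s :* c)) refl (ι (suc k)) S′ (ι (m C suc k)) ⟩
    ι (suc k) * (S′ * ι (m C suc k))            ∎)
    where
    S  = expSum (ι k * w) k
    S′ = expSum (ι (suc k) * w) (suc k)
    secant : (1ℚ + w) * S ≤ S′
    secant = subst (λ x → (1ℚ + w) * S ≤ expSum x (suc k)) (sym (ι-suc k w))
      (expSum-secant (0≤ι k ⊗ 0≤w) 0≤w k)

  ∑-bounded-above : ∀ {A : Set} k c (f : A → ℕ) → (∀ x → k * ι (f x) ≤ c) →
                    ∀ xs → k * ι (∑ xs f) ≤ ι (length xs) * c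
  ∑-bounded-above k c f f≤ []       = ≤-reflexive (trans (*-zeroʳ k) (sym (*-zeroˡ c)))
  ∑-bounded-above k c f f≤ (x ∷ xs) = begin
    k * ι (f x ℕ.+ ∑ xs f)            ≡⟨ cong (_*_ k) (ι-+ (f x) (∑ xs f)) ⟩
    k * (ι (f x) + ι (∑ xs f))        ≡⟨ *-distribˡ-+ k _ _ ⟩
    k * ι (f x) + k * ι (∑ xs f)      ≤⟨ +-mono-≤ (f≤ x) (∑-bounded-above k c f f≤ xs) ⟩
    c + ι (length xs) * c             ≡⟨ trans (+-comm c _) (sym (ι-suc (length xs) c)) ⟩
    ι (suc (length xs)) * c           ∎

  ∑-bounded-below : ∀ {A : Set} k c (f : A → ℕ) → (∀ x → c ≤ k * ι (f x)) →
                    ∀ xs → ι (length xs) * c ≤ k * ι (∑ xs f)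
  ∑-bounded-below k c f ≤f []       = ≤-reflexive (trans (*-zeroˡ c) (sym (*-zeroʳ k)))
  ∑-bounded-below k c f ≤f (x ∷ xs) = begin
    ι (suc (length xs)) * c           ≡⟨ trans (ι-suc (length xs) c) (+-comm _ c) ⟩
    c + ι (length xs) * c             ≤⟨ +-mono-≤ (≤f x) (∑-bounded-below k c f ≤f xs) ⟩
    k * ι (f x) + k * ι (∑ xs f)      ≡⟨ *-distribˡ-+ k _ _ ⟨
    k * (ι (f x) + ι (∑ xs f))        ≡⟨ cong (_*_ k) (ι-+ (f x) (∑ xs f)) ⟨
    k * ι (f x ℕ.+ ∑ xs f)            ∎

  expectation≡ : ∀ {A : Set} (f : A → ℕ) ωs → ι (length ωs) * expectation f ωs ≡ ι (∑ ωs f)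
  expectation≡ f []           = refl
  expectation≡ f ωs@(_ ∷ _)   = ι-cancel (length ωs) (∑ ωs f)

  private
    -- As n + a ≤ 7n², at least n³ - 7n² spaces remain in u ∸ k. In (6n + 58)(n³ - 7n²) the surplus
    -- 58 - 42 = 16 leaves 16n³, which must cover (7 · 58 + 1) n² = 407n²; since 16 · 26 = 416, n ≥
    -- 26 suffices.
    few-attackers : ∀ n a u k → 26 ℕ.≤ n → k ℕ.≤ n → a ℕ.≤ 6 ℕ.* (n ℕ.* n) ℕ.+ 1 → u ℕ.+ a ≡ n ℕ.^ 3 →
             n ℕ.* n ℕ.* a ℕ.≤ (6 ℕ.* n ℕ.+ 58) ℕ.* (u ∸ k)
    few-attackers n a u k 26≤n k≤n a≤ u+a≡n³ = ℕ.+-cancelʳ-≤ (c ℕ.* (n ℕ.+ a)) _ _ (ℕR.begin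
      n ℕ.* n ℕ.* a ℕ.+ c ℕ.* (n ℕ.+ a)
        ℕR.≤⟨ ℕ.+-mono-≤ (ℕ.*-monoʳ-≤ (n ℕ.* n) a≤) (ℕ.*-monoʳ-≤ c (ℕ.+-monoʳ-≤ n a≤)) ⟩
      n ℕ.* n ℕ.* (6 ℕ.* (n ℕ.* n) ℕ.+ 1) ℕ.+ c ℕ.* (n ℕ.+ (6 ℕ.* (n ℕ.* n) ℕ.+ 1))
        ℕR.≡⟨ cong (λ z → n ℕ.* n ℕ.* (6 ℕ.* (n ℕ.* n) ℕ.+ 1) ℕ.+ c ℕ.* z) (shift n) ⟩
      n ℕ.* n ℕ.* (6 ℕ.* (n ℕ.* n) ℕ.+ 1) ℕ.+ c ℕ.* (suc n ℕ.+ 6 ℕ.* (n ℕ.* n))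
        ℕR.≤⟨ ℕ.+-monoʳ-≤ (n ℕ.* n ℕ.* (6 ℕ.* (n ℕ.* n) ℕ.+ 1))
                (ℕ.*-monoʳ-≤ c (ℕ.+-monoˡ-≤ (6 ℕ.* (n ℕ.* n)) suc-n≤n²)) ⟩
      n ℕ.* n ℕ.* (6 ℕ.* (n ℕ.* n) ℕ.+ 1) ℕ.+ c ℕ.* (n ℕ.* n ℕ.+ 6 ℕ.* (n ℕ.* n))
        ℕR.≡⟨ expand n ⟩
      6 ℕ.* (n ℕ.* n ℕ.* (n ℕ.* n)) ℕ.+ 42 ℕ.* (n ℕ.* (n ℕ.* n)) ℕ.+ 407 ℕ.* (n ℕ.* n)
        ℕR.≤⟨ ℕ.+-monoʳ-≤ _ (ℕ.*-monoˡ-≤ (n ℕ.* n)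
                (ℕ.≤-trans (ℕ.m≤n+m 407 9) (ℕ.*-monoʳ-≤ 16 26≤n))) ⟩
      6 ℕ.* (n ℕ.* n ℕ.* (n ℕ.* n)) ℕ.+ 42 ℕ.* (n ℕ.* (n ℕ.* n)) ℕ.+ 16 ℕ.* n ℕ.* (n ℕ.* n)
        ℕR.≡⟨ collect n ⟩
      c ℕ.* n ℕ.^ 3                          ℕR.≡⟨ cong (ℕ._*_ c) u+a≡n³ ⟨
      c ℕ.* (u ℕ.+ a)
        ℕR.≤⟨ ℕ.*-monoʳ-≤ c (ℕ.+-monoˡ-≤ a (ℕ.≤-trans (ℕ.m≤n+m∸n u k) (ℕ.+-monoˡ-≤ (u ∸ k) k≤n))) ⟩
      c ℕ.* (n ℕ.+ (u ∸ k) ℕ.+ a)            ℕR.≡⟨ split c n (u ∸ k) a ⟩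
      c ℕ.* (u ∸ k) ℕ.+ c ℕ.* (n ℕ.+ a)      ℕR.∎)
      where
      module ℕR = ℕ.≤-Reasoning
      c = 6 ℕ.* n ℕ.+ 58
      suc-n≤n² : suc n ℕ.≤ n ℕ.* n
      suc-n≤n² = ℕ.m<m*n n n {{ℕ.>-nonZero (ℕ.≤-trans (ℕ.s≤s ℕ.z≤n) 26≤n)}}
                   (ℕ.≤-trans (ℕ.s≤s (ℕ.s≤s ℕ.z≤n)) 26≤n)
      shift : ∀ n → n ℕ.+ (6 ℕ.* (n ℕ.* n) ℕ.+ 1) ≡ suc n ℕ.+ 6 ℕ.* (n ℕ.* n)
      shift = ℕ-Solver.solve-∀
      expand : ∀ n → n ℕ.* n ℕ.* (6 ℕ.* (n ℕ.* n) ℕ.+ 1) ℕ.+ (6 ℕ.* n ℕ.+ 58) ℕ.* (n ℕ.* n ℕ.+ 6 ℕ.* (n ℕ.* n)) ≡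
        6 ℕ.* (n ℕ.* n ℕ.* (n ℕ.* n)) ℕ.+ 42 ℕ.* (n ℕ.* (n ℕ.* n)) ℕ.+ 407 ℕ.* (n ℕ.* n)
      expand = ℕ-Solver.solve-∀
      collect : ∀ n → 6 ℕ.* (n ℕ.* n ℕ.* (n ℕ.* n)) ℕ.+ 42 ℕ.* (n ℕ.* (n ℕ.* n)) ℕ.+ 16 ℕ.* n ℕ.* (n ℕ.* n) ≡
        (6 ℕ.* n ℕ.+ 58) ℕ.* (n ℕ.* (n ℕ.* (n ℕ.* 1)))
      collect = ℕ-Solver.solve-∀
      split : ∀ c n d a → c ℕ.* (n ℕ.+ d ℕ.+ a) ≡ c ℕ.* d ℕ.+ c ℕ.* (n ℕ.+ a)
      split = ℕ-Solver.solve-∀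

  module _ (m : ℕ) where

    private
      n = suc m
      N = n ℕ.^ 3

    -- The number of pairs of a space and a board, which is the common denominator of `μ n`.
    outcomes : ℚ
    outcomes = ι N * ι (N C n)

    0<N : 0ℚ < ι N
    0<N = 0<ι {N} (ℕ.m^n>0 n 3)

    0<outcomes : 0ℚ < outcomes
    0<outcomes = *-pos 0<N (0<ι (C-positive (ℕ.m≤m*n n (n ℕ.^ 2))))

    outcomes*μ : outcomes * μ n ≡ ι (∑ (spaces n) (λ x → unattacked x C n))
    outcomes*μ = trans
        (solve 4 (λ n c e r → n :* c :* (e :* r) := (c :* e) :* (n :* r)) refl (ι N) (ι (N C n)) E r)
        (trans (cong₂ _*_
          (trans (cong (λ l → ι l * E) (sym (trans (length-choose n (spaces n)) (cong (_C n) (length-spaces n)))))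
                 (trans (expectation≡ numSafe (configurations n)) (cong ι (∑-numSafe {n}))))
          (ι-cancel N {{ℕ.m^n≢0 n 3}} 1))
        (*-identityʳ _))
      where
      E = expectation numSafe (configurations n)
      r = (+ 1 / N) {{ℕ.m^n≢0 n 3}}

    μ-≤ : ∀ s → (∀ x → s * ι (unattacked {n} x C n) ≤ ι (N C n)) → s * μ n ≤ 1ℚ
    μ-≤ s bound = *-cancelˡ 0<outcomes (begin
      outcomes * (s * μ n)
        ≡⟨ solve 3 (λ o s u → o :* (s :* u) := s :* (o :* u)) refl outcomes s (μ n) ⟩
      s * (outcomes * μ n)                                    ≡⟨ cong (_*_ s) outcomes*μ ⟩
      s * ι (∑ (spaces n) (λ x → unattacked x C n))
        ≤⟨ ∑-bounded-above s (ι (N C n)) (λ x → unattacked x C n) bound (spaces n) ⟩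
      ι (length (spaces n)) * ι (N C n)                       ≡⟨ cong (λ l → ι l * ι (N C n)) (length-spaces n) ⟩
      outcomes                                                ≡⟨ *-identityʳ outcomes ⟨
      outcomes * 1ℚ                                           ∎)

    μ-≥ : ∀ s → (∀ x → ι (N C n) ≤ s * ι (unattacked {n} x C n)) → 1ℚ ≤ s * μ n
    μ-≥ s bound = *-cancelˡ 0<outcomes (begin
      outcomes * 1ℚ                                           ≡⟨ *-identityʳ outcomes ⟩
      outcomes                                                ≡⟨ cong (λ l → ι l * ι (N C n)) (length-spaces n) ⟨
      ι (length (spaces n)) * ι (N C n)
        ≤⟨ ∑-bounded-below s (ι (N C n)) (λ x → unattacked x C n) bound (spaces n) ⟩
      s * ι (∑ (spaces n) (λ x → unattacked x C n))           ≡⟨ cong (_*_ s) outcomes*μ ⟨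
      s * (outcomes * μ n)
        ≡⟨ solve 3 (λ o s u → o :* (s :* u) := s :* (o :* u)) refl outcomes s (μ n) ⟨
      outcomes * (s * μ n)                                    ∎)

    0≤μ : 0ℚ ≤ μ n
    0≤μ = *-cancelˡ 0<outcomes (begin
      outcomes * 0ℚ    ≡⟨ *-zeroʳ outcomes ⟩
      0ℚ               ≤⟨ 0≤ι (∑ (spaces n) (λ x → unattacked x C n)) ⟩
      ι (∑ (spaces n) (λ x → unattacked x C n))  ≡⟨ outcomes*μ ⟨
      outcomes * μ n   ∎)

    private
      ιN≡ : ι N ≡ ι n * (ι n * ι n)
      ιN≡ = trans (cong ι (cong (λ k → n ℕ.* (n ℕ.* k)) (ℕ.*-identityʳ n)))
                  (trans (ι-* n (n ℕ.* n)) (cong (_*_ (ι n)) (ι-* n n)))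

    μ-upper : ∀ K v → 0ℚ ≤ v → v + ι 15 * ⅟ m ≡ + 9 / 2 → expSum v K * μ n ≤ 1ℚ
    μ-upper K v 0≤v v+δ≡9/2 = μ-≤ (expSum v K) (λ x →
      subst (λ e → expSum e K * ι (unattacked x C n) ≤ ι (N C n)) nt≡v
        (C-ratio-≤ K (unattacked x) N (0≤v ⊗ 0≤⅟ m)
          (ℕ.≤-trans (ℕ.m≤m+n _ _) (ℕ.≤-reflexive (unattacked+attackers x))) 0<N (sparse x) n))
      where
      -- Since n = `suc m`, `⅟ m` is 1/n. Then t n³ = v n² = 9n²/2 - 15n is at most the number of
      -- attackers, where 15 is half of the 30 in `attackers-≥`; the n pieces give the exponent n t
      -- = v.
      t = v * ⅟ m
      nt≡v : ι n * t ≡ v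
      nt≡v = trans (solve 3 (λ n v r → n :* (v :* r) := v :* (n :* r)) refl (ι n) v (⅟ m))
                   (trans (cong (_*_ v) (ι-cancel n 1)) (*-identityʳ v))
      v≡ : v ≡ + 9 / 2 - ι 15 * ⅟ m
      v≡ = trans (solve 2 (λ v d → v := v :+ d :- d) refl v (ι 15 * ⅟ m)) (cong (_- ι 15 * ⅟ m) v+δ≡9/2)
      2tN≡ : ι 2 * (t * ι N) ≡ ι 9 * (ι n * ι n) - ι 30 * ι n
      2tN≡ = trans (cong (λ z → ι 2 * (t * z)) ιN≡)
        (trans (solve 3 (λ v r n → con (ι 2) :* ((v :* r) :* (n :* (n :* n))) := con (ι 2) :* v :* (n :* r) :* (n :* n))
                  refl v (⅟ m) (ι n))
        (trans (cong (λ z → ι 2 * v * z * (ι n * ι n)) (ι-cancel n 1))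
        (trans (cong (λ z → ι 2 * z * 1ℚ * (ι n * ι n)) v≡)
        (trans (solve 2 (λ r n → con (ι 2) :* (con (+ 9 / 2) :- con (ι 15) :* r) :* con 1ℚ :* (n :* n) :=
                                 con (ι 9) :* (n :* n) :- con (ι 30) :* n :* (n :* r)) refl (⅟ m) (ι n))
        (trans (cong (λ z → ι 9 * (ι n * ι n) - ι 30 * ι n * z) (ι-cancel n 1))
               (cong (_-_ (ι 9 * (ι n * ι n))) (*-identityʳ (ι 30 * ι n))))))))
      tN≤a : ∀ x → t * ι N ≤ ι (attackers x)
      tN≤a x = *-cancelˡ (0<ι-suc 1) (begin
        ι 2 * (t * ι N)                          ≡⟨ 2tN≡ ⟩
        ι 9 * (ι n * ι n) - ι 30 * ι n           ≤⟨ ≤+⇒-≤ (begin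
          ι 9 * (ι n * ι n)                      ≡⟨ trans (ι-* 9 (n ℕ.* n)) (cong (_*_ (ι 9)) (ι-* n n)) ⟨
          ι (9 ℕ.* (n ℕ.* n))                    ≤⟨ ι-mono (attackers-≥ x) ⟩
          ι (2 ℕ.* attackers x ℕ.+ 30 ℕ.* n)     ≡⟨ trans (ι-+ (2 ℕ.* attackers x) (30 ℕ.* n))
                                                      (cong₂ _+_ (ι-* 2 (attackers x)) (ι-* 30 n)) ⟩
          ι 2 * ι (attackers x) + ι 30 * ι n     ∎) ⟩
        ι 2 * ι (attackers x)                    ∎)
      sparse : ∀ x → ι (unattacked x) ≤ (1ℚ - t) * ι N
      sparse x = begin
        ι (unattacked x)
          ≡⟨ solve 2 (λ u a → u := u :+ a :- a) refl (ι (unattacked x)) (ι (attackers x)) ⟩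
        ι (unattacked x) + ι (attackers x) - ι (attackers x)
          ≡⟨ cong (_- ι (attackers x)) (trans (sym (ι-+ (unattacked x) (attackers x)))
               (cong ι (unattacked+attackers x))) ⟩
        ι N - ι (attackers x)     ≤⟨ +-monoʳ-≤ (ι N) (neg-antimono-≤ (tN≤a x)) ⟩
        ι N - t * ι N             ≡⟨ solve 2 (λ n t → n :- t :* n := (con 1ℚ :- t) :* n) refl (ι N) t ⟩
        (1ℚ - t) * ι N            ∎

    μ-lower : 26 ℕ.≤ n → 1ℚ ≤ expSum (ι 6 + ι 58 * ⅟ m) n * μ n
    μ-lower 26≤n = μ-≥ (expSum v n) (λ x →
      subst (λ e → ι (N C n) ≤ expSum e n * ι (unattacked x C n)) nw≡v
        (C-ratio-≥ (unattacked x) N n (0≤v ⊗ 0≤⅟ m) (factor x) n ℕ.≤-refl))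
      where
      v = ι 6 + ι 58 * ⅟ m
      -- With w = (6n + 58)/n², `few-attackers` says that a ≤ w (u ∸ k), so the quotient of
      -- consecutive factors is at most 1 + w; n pieces give the exponent n w = v.
      w = v * ⅟ m
      0≤v : 0ℚ ≤ v
      0≤v = ≤-trans (≤-reflexive (sym (+-identityʳ 0ℚ))) (+-mono-≤ (0≤ι 6) (0≤ι 58 ⊗ 0≤⅟ m))
      nw≡v : ι n * w ≡ v
      nw≡v = trans (solve 3 (λ n v r → n :* (v :* r) := v :* (n :* r)) refl (ι n) v (⅟ m))
                   (trans (cong (_*_ v) (ι-cancel n 1)) (*-identityʳ v))
      nnw≡ : ι n * ι n * w ≡ ι (6 ℕ.* n ℕ.+ 58)
      nnw≡ = trans (*-assoc (ι n) (ι n) w) (trans (cong (_*_ (ι n)) nw≡v)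
        (trans (solve 2 (λ n r → n :* (con (ι 6) :+ con (ι 58) :* r) := con (ι 6) :* n :+ con (ι 58) :* (n :* r))
                  refl (ι n) (⅟ m))
        (trans (cong (λ z → ι 6 * ι n + ι 58 * z) (ι-cancel n 1))
        (trans (cong₂ _+_ (sym (ι-* 6 n)) (*-identityʳ (ι 58))) (sym (ι-+ (6 ℕ.* n) 58))))))
      factor : ∀ x k → k ℕ.≤ n → ι (N ∸ k) ≤ (1ℚ + w) * ι (unattacked x ∸ k)
      factor x k k≤n = begin
        ι (N ∸ k)                            ≤⟨ ι-mono N∸k≤ ⟩
        ι ((u ∸ k) ℕ.+ a)                    ≡⟨ ι-+ (u ∸ k) a ⟩
        ι (u ∸ k) + ι a                      ≤⟨ +-monoʳ-≤ (ι (u ∸ k)) a≤ ⟩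
        ι (u ∸ k) + w * ι (u ∸ k)            ≡⟨ solve 2 (λ d w → d :+ w :* d := (con 1ℚ :+ w) :* d) refl (ι (u ∸ k)) w ⟩
        (1ℚ + w) * ι (u ∸ k)                 ∎
        where
        a = attackers x
        u = unattacked x
        N∸k≤ : N ∸ k ℕ.≤ (u ∸ k) ℕ.+ a
        N∸k≤ = ℕ.m≤n+o⇒m∸n≤o N k (ℕ.≤-trans (ℕ.≤-reflexive (sym (unattacked+attackers x)))
          (ℕ.≤-trans (ℕ.+-monoˡ-≤ a (ℕ.m≤n+m∸n u k)) (ℕ.≤-reflexive (ℕ.+-assoc k (u ∸ k) a))))
        a≤ : ι a ≤ w * ι (u ∸ k)
        a≤ = *-cancelˡ (*-pos (0<ι-suc m) (0<ι-suc m)) (begin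
          ι n * ι n * ι a                    ≡⟨ trans (ι-* (n ℕ.* n) a) (cong (_* ι a) (ι-* n n)) ⟨
          ι (n ℕ.* n ℕ.* a)                  ≤⟨ ι-mono (few-attackers n a u k 26≤n k≤n (attackers-≤ x)
                                                  (unattacked+attackers x)) ⟩
          ι ((6 ℕ.* n ℕ.+ 58) ℕ.* (u ∸ k))   ≡⟨ trans (ι-* (6 ℕ.* n ℕ.+ 58) (u ∸ k)) (cong (_* ι (u ∸ k)) (sym nnw≡)) ⟩
          ι n * ι n * w * ι (u ∸ k)          ≡⟨ *-assoc (ι n * ι n) w (ι (u ∸ k)) ⟩
          ι n * ι n * (w * ι (u ∸ k))        ∎)

  private
    0<p-r : ∀ {p r} → r < p → 0ℚ < p - r
    0<p-r {p} {r} r<p = subst (_< p - r) (+-inverseʳ r) (+-monoˡ-< (- r) r<p)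

    1≤S : ∀ x {{_ : NonNegative x}} k → 1ℚ ≤ expSum x k
    1≤S x {{0≤x}} = ExpConvergence.1≤S x 0≤x

    1/S : ∀ x {{_ : NonNegative x}} → ℕ → ℚ
    1/S x k = seq (1/exp x) k

    1/S*S : ∀ x {{_ : NonNegative x}} k → 1/S x k * expSum x k ≡ 1ℚ
    1/S*S x k = *-inverseˡ (expSum x k) {{1≤p⇒nonZero (1≤S x k)}}

    0≤1/S : ∀ x {{_ : NonNegative x}} k → 0ℚ ≤ 1/S x k
    0≤1/S x k = <⇒≤ (positive⁻¹ (1/S x k)
      {{1/pos⇒pos (expSum x k) {{positive (<-≤-trans (positive⁻¹ 1ℚ) (1≤S x k))}}}})

    1/S≤1 : ∀ x {{_ : NonNegative x}} k → 1/S x k ≤ 1ℚ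
    1/S≤1 x k = begin
      1/S x k               ≡⟨ *-identityʳ (1/S x k) ⟨
      1/S x k * 1ℚ          ≤⟨ *-monoˡ (0≤1/S x k) (1≤S x k) ⟩
      1/S x k * expSum x k  ≡⟨ 1/S*S x k ⟩
      1ℚ                    ∎

  -- A single index M from the upper cut is enough, because `μ-upper` holds at every truncation.
  -- Moving the argument from 9/2 - δ back to 9/2 by the tangent inequality gives μ ≤ 1/S + δ, with
  -- S the partial sum at 9/2 of index M and δ = 15/n.
  μ-limsup : (λ m → μ (suc m)) limsup≤ 1/exp (+ 9 / 2)
  μ-limsup {q} (r , r<q , M , 1/S≤r) with <-dense r<q
  ... | p , r<p , p<q = p , p<q , N₁ ℕ.+ N₂ , bound
    where
    9/2 = + 9 / 2
    -- Beyond `N₁` the error δ fits between r and p; beyond `N₂` it is at most 1, which keeps v =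
    -- 9/2 - δ nonnegative.
    N₁ = proj₁ (eventually-small 15 (p - r) (0<p-r r<p))
    N₂ = proj₁ (eventually-small 15 1ℚ (positive⁻¹ 1ℚ))
    bound : ∀ m → N₁ ℕ.+ N₂ ℕ.≤ m → μ (suc m) ≤ p
    bound m N≤m = begin
      u                                ≡⟨ trans (cong (_* u) (1/S*S 9/2 M)) (*-identityˡ u) ⟨
      s * S * u                        ≤⟨ *-monoʳ (0≤μ m) (*-monoˡ (0≤1/S 9/2 M) tangent) ⟩
      s * (V + δ * S) * u
        ≡⟨ solve 5 (λ s v d t u → s :* (v :+ d :* t) :* u := s :* (v :* u) :+ d :* (s :* t) :* u) refl s V δ S u ⟩
      s * (V * u) + δ * (s * S) * u
        ≤⟨ +-mono-≤ (*-monoˡ (0≤1/S 9/2 M) Vu≤1)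
                    (≤-reflexive (cong (λ z → δ * z * u) (1/S*S 9/2 M))) ⟩
      s * 1ℚ + δ * 1ℚ * u
        ≡⟨ cong₂ _+_ (*-identityʳ s) (cong (_* u) (*-identityʳ δ)) ⟩
      s + δ * u                        ≤⟨ +-mono-≤ (1/S≤r M ℕ.≤-refl) (*-monoˡ 0≤δ u≤1) ⟩
      r + δ * 1ℚ                       ≤⟨ +-monoʳ-≤ r (≤-trans (≤-reflexive (*-identityʳ δ)) δ≤p-r) ⟩
      r + (p - r)                      ≡⟨ solve 2 (λ r p → r :+ (p :- r) := p) refl r p ⟩
      p                                ∎
      where
      u = μ (suc m)
      s = 1/S 9/2 M
      δ = ι 15 * ⅟ m
      v = 9/2 - δ
      S = expSum 9/2 M
      V = expSum v M
      0≤δ : 0ℚ ≤ δ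
      0≤δ = 0≤ι 15 ⊗ 0≤⅟ m
      δ≤p-r : δ ≤ p - r
      δ≤p-r = proj₂ (eventually-small 15 (p - r) (0<p-r r<p)) m (ℕ.≤-trans (ℕ.m≤m+n N₁ N₂) N≤m)
      δ≤1 : δ ≤ 1ℚ
      δ≤1 = proj₂ (eventually-small 15 1ℚ (positive⁻¹ 1ℚ)) m (ℕ.≤-trans (ℕ.m≤n+m N₂ N₁) N≤m)
      v+δ≡ : v + δ ≡ 9/2
      v+δ≡ = solve 2 (λ n d → n :- d :+ d := n) refl 9/2 δ
      0≤v : 0ℚ ≤ v
      0≤v = ≤-trans (nonNegative⁻¹ (9/2 - 1ℚ)) (+-monoʳ-≤ 9/2 (neg-antimono-≤ δ≤1))
      Vu≤1 : V * u ≤ 1ℚ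
      Vu≤1 = μ-upper m M v 0≤v v+δ≡
      u≤1 : u ≤ 1ℚ
      u≤1 = begin
        u         ≡⟨ *-identityˡ u ⟨
        1ℚ * u    ≤⟨ *-monoʳ (0≤μ m) (1≤expSum 0≤v M) ⟩
        V * u     ≤⟨ Vu≤1 ⟩
        1ℚ        ∎
      tangent : S ≤ V + δ * S
      tangent = subst (λ x → expSum x M ≤ V + δ * expSum x M) v+δ≡ (expSum-tangent 0≤v 0≤δ M)

  -- The tangent inequality moves the argument 6 + δ back to 6 at the cost of a factor 1 - δ, where
  -- δ = 58/n; since 1/S ≤ 1, this yields μ ≥ 1/S - δ.
  μ-liminf : 1/exp (+ 6 / 1) ≤liminf (λ m → μ (suc m))
  μ-liminf {q} (r , q<r , M , r≤1/S) with <-dense q<r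
  ... | p , q<p , p<r = p , q<p , N₁ ℕ.+ N₂ ℕ.+ 26 , bound
    where
    -- `N₁` makes δ fit between p and r, `N₂` makes 1 - δ nonnegative so that it may multiply
    -- inequalities, and 26 is the threshold of `few-attackers`.
    N₁ = proj₁ (eventually-small 58 (r - p) (0<p-r p<r))
    N₂ = proj₁ (eventually-small 58 1ℚ (positive⁻¹ 1ℚ))
    bound : ∀ m → N₁ ℕ.+ N₂ ℕ.+ 26 ℕ.≤ m → p ≤ μ (suc m)
    bound m N≤m = begin
      p                          ≡⟨ solve 2 (λ p r → p := r :- (r :- p)) refl p r ⟩
      r - (r - p)                ≤⟨ +-mono-≤ (r≤1/S k (ℕ.m≤m+n M n)) (neg-antimono-≤ δ≤r-p) ⟩
      s - δ                      ≤⟨ +-monoʳ-≤ s (neg-antimono-≤ (≤-trans (*-monoʳ 0≤δ (1/S≤1 (ι 6) k))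
                                      (≤-reflexive (*-identityˡ δ)))) ⟩
      s - s * δ                  ≡⟨ solve 2 (λ s d → s :- s :* d := s :* ((con 1ℚ :- d) :* con 1ℚ)) refl s δ ⟩
      s * ((1ℚ - δ) * 1ℚ)        ≤⟨ *-monoˡ (0≤1/S (ι 6) k) (*-monoˡ 0≤1-δ (μ-lower m 26≤n)) ⟩
      s * ((1ℚ - δ) * (V * u))
        ≡⟨ solve 4 (λ s d v u → s :* ((con 1ℚ :- d) :* (v :* u)) := s :* ((v :- d :* v) :* u)) refl s δ V u ⟩
      s * ((V - δ * V) * u)      ≤⟨ *-monoˡ (0≤1/S (ι 6) k) (*-monoʳ (0≤μ m)
                                      (≤-trans (≤+⇒-≤ tangent) (expSum-mono (0≤ι 6) (ℕ.≤⇒≤′ (ℕ.m≤n+m n M))))) ⟩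
      s * (expSum (ι 6) k * u)   ≡⟨ *-assoc s (expSum (ι 6) k) u ⟨
      s * expSum (ι 6) k * u     ≡⟨ trans (cong (_* u) (1/S*S (ι 6) k)) (*-identityˡ u) ⟩
      u                          ∎
      where
      n = suc m
      -- The index has to be at least M for the lower cut to apply, and at least n for its partial
      -- sum to dominate the one coming from `μ-lower`, whose index grows with n.
      k = M ℕ.+ n
      u = μ n
      s = 1/S (ι 6) k
      δ = ι 58 * ⅟ m
      V = expSum (ι 6 + δ) n
      0≤δ : 0ℚ ≤ δ
      0≤δ = 0≤ι 58 ⊗ 0≤⅟ m
      δ≤r-p : δ ≤ r - p
      δ≤r-p = proj₂ (eventually-small 58 (r - p) (0<p-r p<r)) m
        (ℕ.≤-trans (ℕ.m≤m+n N₁ N₂) (ℕ.≤-trans (ℕ.m≤m+n (N₁ ℕ.+ N₂) 26) N≤m))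
      δ≤1 : δ ≤ 1ℚ
      δ≤1 = proj₂ (eventually-small 58 1ℚ (positive⁻¹ 1ℚ)) m
        (ℕ.≤-trans (ℕ.m≤n+m N₂ N₁) (ℕ.≤-trans (ℕ.m≤m+n (N₁ ℕ.+ N₂) 26) N≤m))
      0≤1-δ : 0ℚ ≤ 1ℚ - δ
      0≤1-δ = subst (_≤ 1ℚ - δ) (+-inverseʳ δ) (+-monoˡ-≤ (- δ) δ≤1)
      26≤n : 26 ℕ.≤ n
      26≤n = ℕ.m≤n⇒m≤1+n (ℕ.≤-trans (ℕ.m≤n+m 26 (N₁ ℕ.+ N₂)) N≤m)
      tangent : V ≤ expSum (ι 6) n + δ * V
      tangent = expSum-tangent (0≤ι 6) 0≤δ n

  liminf-below-limsup : ∀ a → liminf≤limsup a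
  liminf-below-limsup a (r , q<r , M , r≤a) (s , s<t , N , a≤s) =
    <-≤-trans q<r (≤-trans (r≤a (M ℕ.+ N) (ℕ.m≤m+n M N))
      (≤-trans (a≤s (M ℕ.+ N) (ℕ.m≤n+m N M)) (<⇒≤ s<t)))

mainTheorem9 : 1/exp (+ 6 / 1) ≤liminf (λ m → μ (suc m))
    × liminf≤limsup (λ m → μ (suc m))
    × (λ m → μ (suc m)) limsup≤ 1/exp (+ 9 / 2)
mainTheorem9 = μ-liminf , liminf-below-limsup (λ m → μ (suc m)) , μ-limsup
  where open Asymptotics
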